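{- For all positive integers $n, r$ with $r \ge 2$, we have $$\widetilde{A}^+_{n,r}(t) = \sum_{i=0}^{\lfloor n/2 \rfloor} \widetilde{\gamma}^+_{n,r,i} \, t^i (1+t)^{n-2i}, \qquad \widetilde{A}^-_{n,r}(t) = \sum_{i=1}^{\lfloor (n+1)/2 \rfloor} \widetilde{\gamma}^-_{n,r,i} \, t^i (1+t)^{n+1-2i},$$ where $$\widetilde{\gamma}^+_{n,r,i} := \sum_{k=2i}^n \binom{n}{k} \xi^+_{k,r,i}, \qquad \widetilde{\gamma}^-_{n,r,i} := \sum_{k=2i}^n \binom{n}{k} \xi^-_{k,r,i}.$$ As a result: (i) $\widetilde{\gamma}^+_{n,r,i}$ is equal to the number of $w \in \mathbb{Z}_r \wr \mathfrak{S}_{n+1}$ for which $\mathrm{Asc}(w)$ has exactly $i+1$ elements, no two consecutive, and contains $n$, and $w(1) > w(2) > \cdots > w(m) = 1$ have all zero color, for some $m$; (ii) $\widetilde{\gamma}^-_{n,r,i}$ is equal to the number of $w \in \mathbb{Z}_r \wr \mathfrak{S}_{n+1}$ for which $\mathrm{Asc}(w) \subseteq \{1,\dots,n-1\}$ has exactly $i$ elements, no two consecutive, and $w(1) > w(2) > \cdots > w(m) = 1$ have all zero color, for some $m$.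
   Context: **Colored permutations.** Elements of $\mathbb{Z}_r \wr \mathfrak{S}_n$ are represented as pairs $w = (\sigma, \varepsilon)$ with $\sigma \in \mathfrak{S}_n$ and $\varepsilon \in \{0,1,\dots,r-1\}^n$, where $\varepsilon_k$ is the color of $\sigma(k)$. The condition "$w(1) > w(2) > \cdots > w(m) = 1$ have all zero color" means $\sigma(1) > \sigma(2) > \cdots > \sigma(m) = 1$ and $\varepsilon_1 = \cdots = \varepsilon_m = 0$. An index $k \in \{1,\dots,n\}$ is a descent of $w \in \mathbb{Z}_r \wr \mathfrak{S}_n$ if either $\varepsilon_k > \varepsilon_{k+1}$, or $\varepsilon_k = \varepsilon_{k+1}$ and $\sigma(k) > \sigma(k+1)$, where $\sigma(n+1) := n+1$ and $\varepsilon_{n+1} := 0$. The set of ascents $\mathrm{Asc}(w)$ is the complement in $\{1,\dots,n\}$ of the set of descents. **The numbers $\xi^{\pm}$.** For $n \ge 1$, $\xi^+_{n,r,i}$ is the number of $w \in \mathbb{Z}_r \wr \mathfrak{S}_n$ for which $\mathrm{Asc}(w) \subseteq \{2,\dots,n\}$ has exactly $i$ elements, no two consecutive, and contains $n$; $\xi^-_{n,r,i}$ is the number of $w \in \mathbb{Z}_r \wr \mathfrak{S}_n$ for which $\mathrm{Asc}(w) \subseteq \{2,\dots,n-1\}$ has exactly $i-1$ elements, no two consecutive. By convention $\xi^+_{0,r,0} = 1$, $\xi^+_{0,r,i}=0$ for $i\geq 1$, and $\xi^-_{0,r,i} = 0$. **The polynomials.** Set $d^+_{0,r}(t) = 1$,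 $d^-_{0,r}(t) = 0$ and, for $n \ge 1$, $$d^+_{n,r}(t) = \sum_{i=1}^{\lfloor n/2 \rfloor} \xi^+_{n,r,i}\, t^i(1+t)^{n-2i}, \qquad d^-_{n,r}(t) = \sum_{i=1}^{\lfloor (n+1)/2 \rfloor} \xi^-_{n,r,i}\, t^i(1+t)^{n+1-2i}.$$ (Their sum is the derangement polynomial of $\mathbb{Z}_r\wr\mathfrak{S}_n$, that is, the generating polynomial of the excedance number over colored permutations with no fixed point of zero color.) Then $$A^{\pm}_{n,r}(t) = \sum_{k=0}^n \binom{n}{k} d^{\pm}_{k,r}(t), \qquad \widetilde{A}^{\pm}_{n,r}(t) = \sum_{m=0}^n \binom{n}{m} t^{n-m} A^{\pm}_{m,r}(t).$$
   Formalization: Three index corrections: the sum defining γ̃⁻ starts at k=2i−1 (printed 2i; false for n=1); in (i) Asc(w) contains n+1 (printed n; false for n=1, r=3, i=0); in (ii) Asc(w) ⊆ {1,…,n} (printed {1,…,n−1}; false for n=1, i=1 once γ̃⁻ is corrected). -}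

module Defs where

open import Algebra.Bundles using (RawSemiring)
import Algebra.Definitions.RawSemiring
open import Data.Fin.Base as Fin using (Fin; zero; suc; toℕ; inject₁)
import Data.Fin.Permutation as Perm
open import Data.Fin.Permutation using (Permutation′; _⟨$⟩ʳ_)
import Data.Fin.Properties as Fin
open import Data.Fin.Subset using (Subset; _∈_; ∁; ∣_∣)
open import Data.Fin.Subset.Properties using (_∈?_)
open import Data.List.Base as List
  using (List; []; _∷_; allFin; applyUpTo; cartesianProductWith; filter; length)
open import Data.List.Membership.Propositional.Properties using (∈-allFin)
open import Data.List.Relation.Unary.All using ([]; _∷_)
open import Data.List.Relation.Unary.AllPairs using ([]; _∷_)
open import Data.List.Relation.Unary.Any as Any using (Any; here)
import Data.List.Relation.Unary.Any.Properties as Any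
import Data.List.Relation.Unary.Unique.Setoid as Setoid
import Data.List.Relation.Unary.Unique.Setoid.Properties as Unique
open import Data.List.Relation.Unary.Unique.Propositional.Properties using (allFin⁺)
open import Data.Nat.Base
  using (ℕ; zero; suc; _+_; _*_; _∸_; _≤_; _>_; ⌊_/2⌋)
open import Data.Nat.Combinatorics using (_C_)
open import Data.Nat.ListAction using (sum)
open import Data.Nat.Properties using (_≤?_; _>?_; _≟_)
open import Data.Product using (_×_; _,_; ∃)
open import Data.Sum.Base using (_⊎_)
open import Data.Vec.Base as Vec using (Vec; []; _∷_; _∷ʳ_; lookup)
open import Data.Vec.Properties using (∷-injective)
open import Level using (0ℓ)
open import Relation.Binary.Bundles using (Setoid)
open import Relation.Binary.PropositionalEquality
  using (_≡_; refl; sym; trans; cong; cong₂; setoid)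
open import Relation.Nullary using (¬_; Dec; ¬?; does)
open import Relation.Nullary.Decidable using (_×-dec_; _⊎-dec_; _→-dec_)
open import Relation.Unary using (Pred; Decidable)

-- The element k : Fin n stands for the number
-- pos k ∈ {1,…,n}, both as an index and as a value of σ.

pos : ∀ {n} → Fin n → ℕ
pos k = suc (toℕ k)

record ColoredPerm (r n : ℕ) : Set where
  constructor ⟨_,_⟩
  field
    σ : Permutation′ n
    ε : Vec (Fin r) n

open ColoredPerm public

-- Permutations are compared as functions, since _↔_ also carries proofs.
_≋_ : ∀ {r n} → ColoredPerm r n → ColoredPerm r n → Set
v ≋ w = σ v Perm.≈ σ w × ε v ≡ ε w

value : ∀ {r n} → ColoredPerm r n → Fin n → ℕ
value w k = pos (σ w ⟨$⟩ʳ k)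

color : ∀ {r n} → ColoredPerm r n → Fin n → ℕ
color w k = toℕ (lookup (ε w) k)

-- σ(1),…,σ(n),σ(n+1) and ε₁,…,εₙ,εₙ₊₁ with σ(n+1) = n+1 and εₙ₊₁ = 0.

values : ∀ {r n} → ColoredPerm r n → Vec ℕ (suc n)
values {n = n} w = Vec.tabulate (value w) ∷ʳ suc n

colors : ∀ {r n} → ColoredPerm r n → Vec ℕ (suc n)
colors w = Vec.tabulate (color w) ∷ʳ 0

Descent : ∀ {r n} → ColoredPerm r n → Fin n → Set
Descent w k =
    lookup (colors w) (inject₁ k) > lookup (colors w) (suc k)
  ⊎ (lookup (colors w) (inject₁ k) ≡ lookup (colors w) (suc k)
    × lookup (values w) (inject₁ k) > lookup (values w) (suc k))

descent? : ∀ {r n} (w : ColoredPerm r n) → Decidable (Descent w)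
descent? w k = (_ >? _) ⊎-dec ((_ ≟ _) ×-dec (_ >? _))

Des : ∀ {r n} → ColoredPerm r n → Subset n
Des w = Vec.tabulate (λ k → does (descent? w k))

Asc : ∀ {r n} → ColoredPerm r n → Subset n
Asc w = ∁ (Des w)

infix 4 _⊆[_,_] _∋_

_⊆[_,_] : ∀ {n} → Subset n → ℕ → ℕ → Set
S ⊆[ a , b ] = ∀ k → k ∈ S → a ≤ pos k × pos k ≤ b

_∋_ : ∀ {n} → Subset n → ℕ → Set
S ∋ p = ∃ λ k → pos k ≡ p × k ∈ S

NoTwoConsecutive : ∀ {n} → Subset n → Set
NoTwoConsecutive S = ∀ j k → j ∈ S → k ∈ S → ¬ (pos k ≡ suc (pos j))

_⊆[_,_]? : ∀ {n} (S : Subset n) a b → Dec (S ⊆[ a , b ])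
S ⊆[ a , b ]? =
  Fin.all? λ k → (k ∈? S) →-dec ((a ≤? pos k) ×-dec (pos k ≤? b))

_∋?_ : ∀ {n} (S : Subset n) p → Dec (S ∋ p)
S ∋? p = Fin.any? λ k → (pos k ≟ p) ×-dec (k ∈? S)

noTwoConsecutive? : ∀ {n} (S : Subset n) → Dec (NoTwoConsecutive S)
noTwoConsecutive? S = Fin.all? λ j → Fin.all? λ k →
  (j ∈? S) →-dec ((k ∈? S) →-dec ¬? (pos k ≟ suc (pos j)))

DecreasingToOne : ∀ {r n} → ColoredPerm r n → Set
DecreasingToOne {n = n} w = ∃ λ (m : Fin n) →
    value w m ≡ 1
  × (∀ j → j Fin.≤ m → color w j ≡ 0)
  × (∀ j k → j Fin.< k → k Fin.≤ m → value w j > value w k)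

decreasingToOne? : ∀ {r n} → Decidable (DecreasingToOne {r} {n})
decreasingToOne? w = Fin.any? λ m →
        (value w m ≟ 1)
  ×-dec (Fin.all? λ j → (j Fin.≤? m) →-dec (color w j ≟ 0))
  ×-dec (Fin.all? λ j → Fin.all? λ k →
          (j Fin.<? k) →-dec ((k Fin.≤? m) →-dec (value w j >? value w k)))

-- Each colored permutation is listed exactly once up to ≋, see
-- coloredPerms-complete and coloredPerms-unique below.

permutations : ∀ n → List (Permutation′ n)
permutations zero    = Perm.id ∷ []
permutations (suc n) =
  cartesianProductWith (Perm.insert zero) (allFin (suc n)) (permutations n)

words : ∀ r n → List (Vec (Fin r) n)
words r zero    = [] ∷ []
words r (suc n) = cartesianProductWith _∷_ (allFin r) (words r n)

coloredPerms : ∀ r n → List (ColoredPerm r n)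
coloredPerms r n = cartesianProductWith ⟨_,_⟩ (permutations n) (words r n)

count : ∀ {r n} (P : Pred (ColoredPerm r n) 0ℓ) → Decidable P → ℕ
count {r} {n} P P? = length (filter P? (coloredPerms r n))

InΞ⁺ : ∀ {r n} → ℕ → ColoredPerm r n → Set
InΞ⁺ {n = n} i w =
  Asc w ⊆[ 2 , n ] × ∣ Asc w ∣ ≡ i × NoTwoConsecutive (Asc w) × Asc w ∋ n

inΞ⁺? : ∀ {r n} i → Decidable (InΞ⁺ {r} {n} i)
inΞ⁺? {n = n} i w =
        (Asc w ⊆[ 2 , n ]?) ×-dec (∣ Asc w ∣ ≟ i)
  ×-dec noTwoConsecutive? (Asc w) ×-dec (Asc w ∋? n)

-- suc ∣ Asc w ∣ ≡ i says that Asc w has i - 1 elements; in particular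
-- nothing is counted for i = 0.
InΞ⁻ : ∀ {r n} → ℕ → ColoredPerm r n → Set
InΞ⁻ {n = n} i w =
  Asc w ⊆[ 2 , n ∸ 1 ] × suc ∣ Asc w ∣ ≡ i × NoTwoConsecutive (Asc w)

inΞ⁻? : ∀ {r n} i → Decidable (InΞ⁻ {r} {n} i)
inΞ⁻? {n = n} i w =
        (Asc w ⊆[ 2 , n ∸ 1 ]?) ×-dec (suc ∣ Asc w ∣ ≟ i)
  ×-dec noTwoConsecutive? (Asc w)

ξ⁺ : (n r i : ℕ) → ℕ
ξ⁺ zero      r zero    = 1
ξ⁺ zero      r (suc i) = 0
ξ⁺ n@(suc _) r i       = count {r} {n} (InΞ⁺ i) (inΞ⁺? i)

ξ⁻ : (n r i : ℕ) → ℕ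
ξ⁻ zero      r i = 0
ξ⁻ n@(suc _) r i = count {r} {n} (InΞ⁻ i) (inΞ⁻? i)

-- a, a+1, …, b; empty if b < a.
range : ℕ → ℕ → List ℕ
range a b = applyUpTo (a +_) (suc b ∸ a)

∑ : ℕ → ℕ → (ℕ → ℕ) → ℕ
∑ a b f = sum (List.map f (range a b))

syntax ∑ a b (λ k → e) = ∑[ k from a to b ] e

γ̃⁺ : (n r i : ℕ) → ℕ
γ̃⁺ n r i = ∑[ k from 2 * i to n ] ((n C k) * ξ⁺ k r i)

-- The lower limit is 2i-1, not 2i: unlike ξ⁺ k r i, the number ξ⁻ k r i
-- need not vanish for k = 2i-1 (e.g. ξ⁻ 1 r 1 = r-1).
γ̃⁻ : (n r i : ℕ) → ℕ
γ̃⁻ n r i = ∑[ k from 2 * i ∸ 1 to n ] ((n C k) * ξ⁻ k r i)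

-- For w of length n+1 the conditions are "Asc w contains n+1" and
-- "Asc w ⊆ {1,…,n}".  With n and {1,…,n-1} in their place, the counts would
-- differ from γ̃⁺ n r i and γ̃⁻ n r i already for n = 1, r = 3.

InΓ⁺ : ∀ {r n} → ℕ → ColoredPerm r (suc n) → Set
InΓ⁺ {n = n} i w =
    ∣ Asc w ∣ ≡ i + 1 × NoTwoConsecutive (Asc w) × Asc w ∋ n + 1
  × DecreasingToOne w

inΓ⁺? : ∀ {r n} i → Decidable (InΓ⁺ {r} {n} i)
inΓ⁺? {n = n} i w =
        (∣ Asc w ∣ ≟ i + 1) ×-dec noTwoConsecutive? (Asc w)
  ×-dec (Asc w ∋? (n + 1)) ×-dec decreasingToOne? w

InΓ⁻ : ∀ {r n} → ℕ → ColoredPerm r (suc n) → Set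
InΓ⁻ {n = n} i w =
    Asc w ⊆[ 1 , n ] × ∣ Asc w ∣ ≡ i × NoTwoConsecutive (Asc w)
  × DecreasingToOne w

inΓ⁻? : ∀ {r n} i → Decidable (InΓ⁻ {r} {n} i)
inΓ⁻? {n = n} i w =
        (Asc w ⊆[ 1 , n ]?) ×-dec (∣ Asc w ∣ ≟ i)
  ×-dec noTwoConsecutive? (Asc w) ×-dec decreasingToOne? w

-- Polynomials in t over ℕ: the list a₀ ∷ a₁ ∷ ⋯ stands for a₀ + a₁ t + ⋯,
-- and trailing zeros are irrelevant for ≈ᵖ.

Poly : Set
Poly = List ℕ

coeff : Poly → ℕ → ℕ
coeff []      k       = 0
coeff (a ∷ p) zero    = a
coeff (a ∷ p) (suc k) = coeff p k

infix  4 _≈ᵖ_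
infixl 6 _+ᵖ_
infixl 7 _*ᵖ_

_≈ᵖ_ : Poly → Poly → Set
p ≈ᵖ q = ∀ k → coeff p k ≡ coeff q k

_+ᵖ_ : Poly → Poly → Poly
[]      +ᵖ q       = q
(a ∷ p) +ᵖ []      = a ∷ p
(a ∷ p) +ᵖ (b ∷ q) = (a + b) ∷ (p +ᵖ q)

_*ᵖ_ : Poly → Poly → Poly
[]      *ᵖ q = []
(a ∷ p) *ᵖ q = List.map (a *_) q +ᵖ (0 ∷ (p *ᵖ q))

polyRawSemiring : RawSemiring 0ℓ 0ℓ
polyRawSemiring = record
  { Carrier = Poly
  ; _≈_     = _≈ᵖ_
  ; _+_     = _+ᵖ_
  ; _*_     = _*ᵖ_
  ; 0#      = []
  ; 1#      = 1 ∷ []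
  }

-- c ·ᵖ p is the sum of c copies of p.
open Algebra.Definitions.RawSemiring polyRawSemiring public
  using () renaming (_^_ to _^ᵖ_; _×_ to _·ᵖ_)

1ᵖ : Poly
1ᵖ = 1 ∷ []

t : Poly
t = 0 ∷ 1 ∷ []

∑ᵖ : ℕ → ℕ → (ℕ → Poly) → Poly
∑ᵖ a b f = List.foldr _+ᵖ_ [] (List.map f (range a b))

syntax ∑ᵖ a b (λ k → e) = ∑ᵖ[ k from a to b ] e

d⁺ : (n r : ℕ) → Poly
d⁺ zero      r = 1ᵖ
d⁺ n@(suc _) r =
  ∑ᵖ[ i from 1 to ⌊ n /2⌋ ]
    (ξ⁺ n r i ·ᵖ (t ^ᵖ i *ᵖ (1ᵖ +ᵖ t) ^ᵖ (n ∸ 2 * i)))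

d⁻ : (n r : ℕ) → Poly
d⁻ zero      r = []
d⁻ n@(suc _) r =
  ∑ᵖ[ i from 1 to ⌊ n + 1 /2⌋ ]
    (ξ⁻ n r i ·ᵖ (t ^ᵖ i *ᵖ (1ᵖ +ᵖ t) ^ᵖ (n + 1 ∸ 2 * i)))

A⁺ : (n r : ℕ) → Poly
A⁺ n r = ∑ᵖ[ k from 0 to n ] ((n C k) ·ᵖ d⁺ k r)

A⁻ : (n r : ℕ) → Poly
A⁻ n r = ∑ᵖ[ k from 0 to n ] ((n C k) ·ᵖ d⁻ k r)

Ã⁺ : (n r : ℕ) → Poly
Ã⁺ n r = ∑ᵖ[ m from 0 to n ] ((n C m) ·ᵖ (t ^ᵖ (n ∸ m) *ᵖ A⁺ m r))

Ã⁻ : (n r : ℕ) → Poly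
Ã⁻ n r = ∑ᵖ[ m from 0 to n ] ((n C m) ·ᵖ (t ^ᵖ (n ∸ m) *ᵖ A⁻ m r))

permutationSetoid : ℕ → Setoid 0ℓ 0ℓ
permutationSetoid n = record
  { Carrier       = Permutation′ n
  ; _≈_           = Perm._≈_
  ; isEquivalence = record
    { refl  = λ _ → refl
    ; sym   = λ p i → sym (p i)
    ; trans = λ p q i → trans (p i) (q i)
    }
  }

coloredPermSetoid : ℕ → ℕ → Setoid 0ℓ 0ℓ
coloredPermSetoid r n = record
  { Carrier       = ColoredPerm r n
  ; _≈_           = _≋_
  ; isEquivalence = record
    { refl  = (λ _ → refl) , refl
    ; sym   = λ (p , e) → (λ i → sym (p i)) , sym e
    ; trans = λ (p , e) (q , f) → (λ i → trans (p i) (q i)) , trans e f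
    }
  }

insert-cong : ∀ {n} (j : Fin (suc n)) {π ρ : Permutation′ n} →
              π Perm.≈ ρ → Perm.insert zero j π Perm.≈ Perm.insert zero j ρ
insert-cong j π≈ρ zero    = refl
insert-cong j π≈ρ (suc k) = cong (Fin.punchIn j) (π≈ρ k)

insert-injective : ∀ {n} {i j : Fin (suc n)} {π ρ : Permutation′ n} →
                   Perm.insert zero i π Perm.≈ Perm.insert zero j ρ →
                   i ≡ j × π Perm.≈ ρ
insert-injective {i = i} p with refl ← p zero =
  refl , λ k → Fin.punchIn-injective i _ _ (p (suc k))

permutations-complete : ∀ n (π : Permutation′ n) →
                        Any (π Perm.≈_) (permutations n)
permutations-complete zero    π = here λ ()
permutations-complete (suc n) π = Any.cartesianProductWith⁺ (Perm.insert zero)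
  (λ { refl π′≈ρ i →
       trans (sym (Perm.insert-remove zero π i)) (insert-cong _ π′≈ρ i) })
  (∈-allFin (π ⟨$⟩ʳ zero))
  (permutations-complete n (Perm.remove zero π))

permutations-unique : ∀ n → Setoid.Unique (permutationSetoid n) (permutations n)
permutations-unique zero    = [] ∷ []
permutations-unique (suc n) = Unique.cartesianProductWith⁺
  (setoid _) (permutationSetoid n) (permutationSetoid (suc n))
  (Perm.insert zero) insert-injective (allFin⁺ (suc n)) (permutations-unique n)

words-complete : ∀ r n (e : Vec (Fin r) n) → Any (e ≡_) (words r n)
words-complete r zero    []      = here refl
words-complete r (suc n) (c ∷ e) = Any.cartesianProductWith⁺ _∷_
  (cong₂ _∷_) (∈-allFin c) (words-complete r n e)

words-unique : ∀ r n → Setoid.Unique (setoid _) (words r n)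
words-unique r zero    = [] ∷ []
words-unique r (suc n) = Unique.cartesianProductWith⁺
  (setoid _) (setoid _) (setoid _)
  _∷_ ∷-injective (allFin⁺ r) (words-unique r n)

coloredPerms-complete : ∀ r n (w : ColoredPerm r n) →
                        Any (w ≋_) (coloredPerms r n)
coloredPerms-complete r n ⟨ π , e ⟩ = Any.cartesianProductWith⁺ ⟨_,_⟩
  _,_ (permutations-complete n π) (words-complete r n e)

coloredPerms-unique : ∀ r n →
                      Setoid.Unique (coloredPermSetoid r n) (coloredPerms r n)
coloredPerms-unique r n = Unique.cartesianProductWith⁺
  (permutationSetoid n) (setoid _) (coloredPermSetoid r n)
  ⟨_,_⟩ (λ p → p) (permutations-unique n) (words-unique r n)

module Submission where

-- Polynomials.  Write B_x(f)(n) = Σ_m C(n,m) x^(n-m) f(m).  Pascal's rule gives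
-- B_x(f)(n+1) = x B_x(f)(n) + B_x(f ∘ suc)(n), whence B_x ∘ B_y = B_(x+y) by
-- induction.  So Ã = B_t(B_1(d)) = B_(1+t)(d), and the factor (1+t)^(n-k) raises
-- every (1+t)-exponent occurring in d_k to the one required for n.
--
-- Counting.  Removing the first letter j of w and standardizing keeps all
-- ascents but the first.  Let T(n,j) be the number of the w of size n+1 to be
-- counted in (i) or (ii) with w(1) ≤ j+1.  If w(1) > 1, then w(1) is a descent
-- that can be removed, so T(n+1,j+1) = T(n+1,j) + T(n,j); if w(1) = 1, then the
-- remaining word is one counted by ξ.  This is Pascal's recurrence again, so
-- T(n,n) = Σ_k C(n,k) ξ_k.

open import Defs
open import Algebra.Bundles using (CommutativeSemiring; CommutativeMonoid)
import Algebra.Properties.CommutativeMonoid.Mult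
import Algebra.Properties.CommutativeMonoid.Sum
import Algebra.Properties.CommutativeSemigroup
import Algebra.Properties.Semiring.Exp
import Algebra.Properties.Semiring.Mult
import Algebra.Properties.Semiring.Sum
open import Algebra.Structures.Biased using (IsCommutativeSemiringˡ)
open import Data.Bool.Base using (true; false; not)
open import Data.Fin.Base as Fin using (Fin; zero; suc; toℕ; inject₁; punchIn)
import Data.Fin.Permutation as Perm
open import Data.Fin.Permutation using (Permutation′; _⟨$⟩ʳ_)
open import Data.Fin.Properties as Fin using (toℕ<n; toℕ-injective)
open import Data.Fin.Subset using (Subset; inside; outside; _∈_; ∣_∣)
open import Data.List.Base as List
  using ([]; _∷_; allFin; applyUpTo; cartesianProductWith; filter; foldr; length)
open import Data.List.Properties
  using (filter-++; filter-none; filter-≐; length-++; map-++; map-applyUpTo; map-cong; map-tabulate; map-∘)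
import Data.List.Relation.Unary.All as All
open import Data.Nat.Base as ℕ using (ℕ; zero; suc; _∸_; _≤_; _<_; z≤n; s≤s)
open import Data.Nat.Combinatorics using (_C_; nCk+nC[k+1]≡[n+1]C[k+1]; k>n⇒nCk≡0)
import Data.Nat.Properties as ℕ
open import Data.Sum.Base as Sum using (_⊎_; inj₁; inj₂)
open import Data.Vec.Base as Vec using ([]; _∷_; _∷ʳ_; head; here; lookup; there)
open import Data.Vec.Properties using (tabulate-cong)
open import Function.Base using (_∘_; id)
open import Function.Bundles using (_⇔_; mk⇔; Equivalence)
open import Level using (0ℓ)
import Relation.Binary.Reasoning.Setoid
open import Relation.Binary.PropositionalEquality as ≡ using (_≡_; _≢_)
open import Relation.Binary.Structures using (IsEquivalence)
open import Relation.Nullary using (¬_; contradiction; does; no; yes)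
open import Relation.Nullary.Decidable using (_×-dec_; dec-false; dec-true; does-⇔)
open import Relation.Unary using (Pred; Decidable)

-- Sums over ranges and binomial transforms

module RangeSum {c ℓ} (M : CommutativeMonoid c ℓ) where
  open CommutativeMonoid M renaming (ε to 0#)
  open Algebra.Properties.CommutativeMonoid.Sum M using (sum; sum-cong-≋; sum-replicate-zero)
  open Relation.Binary.Reasoning.Setoid setoid

  -- Unfolds to `∑` over the natural numbers and to `∑ᵖ` over polynomials, so a single conversion
  -- lemma serves both.
  ∑[_,_] : ℕ → ℕ → (ℕ → Carrier) → Carrier
  ∑[ a , b ] f = foldr _∙_ 0# (List.map f (range a b))

  -- Opaque, so that the summand can be inferred from a sum.
  opaque
    ∑< : ℕ → (ℕ → Carrier) → Carrier
    ∑< n f = sum {n} (f ∘ toℕ)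

    ∑<-empty : ∀ f → ∑< 0 f ≈ 0#
    ∑<-empty f = refl

    ∑<-suc : ∀ n f → ∑< (suc n) f ≈ f 0 ∙ ∑< n (f ∘ suc)
    ∑<-suc n f = refl

    ∑<-cong : ∀ n {f g : ℕ → Carrier} → (∀ k → k < n → f k ≈ g k) → ∑< n f ≈ ∑< n g
    ∑<-cong n f≈g = sum-cong-≋ {n} λ i → f≈g (toℕ i) (toℕ<n i)

    ∑<-zero : ∀ n {f : ℕ → Carrier} → (∀ k → f k ≈ 0#) → ∑< n f ≈ 0#
    ∑<-zero n f≈0# = trans (∑<-cong n (λ k _ → f≈0# k)) (sum-replicate-zero n)

    ∑<-drop : ∀ a n {f : ℕ → Carrier} → (∀ k → k < a → f k ≈ 0#) →
              ∑< n f ≈ ∑< (n ∸ a) (λ k → f (a ℕ.+ k))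
    ∑<-drop zero    n       z = refl
    ∑<-drop (suc a) zero    z = refl
    ∑<-drop (suc a) (suc n) z =
      trans (trans (∙-congʳ (z 0 (s≤s z≤n))) (identityˡ _)) (∑<-drop a n λ k k<a → z (suc k) (s≤s k<a))

    ∑<-extend : ∀ {m n} {f : ℕ → Carrier} → m ≤ n → (∀ k → m ≤ k → f k ≈ 0#) →
                ∑< m f ≈ ∑< n f
    ∑<-extend {n = n} z≤n       z = sym (∑<-zero n λ k → z k z≤n)
    ∑<-extend         (s≤s m≤n) z = ∙-congˡ (∑<-extend m≤n λ k m≤k → z (suc k) (s≤s m≤k))

    foldr-applyUpTo : ∀ (f : ℕ → Carrier) n → foldr _∙_ 0# (applyUpTo f n) ≈ ∑< n f
    foldr-applyUpTo f zero    = refl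
    foldr-applyUpTo f (suc n) = ∙-congˡ (foldr-applyUpTo (f ∘ suc) n)

  -- Sums whose limits depend on `i` or `k` are brought to a common length in this way, with zero
  -- terms as padding; after that they can be compared and interchanged.
  ∑[,]≈∑< : ∀ a b {n} (f : ℕ → Carrier) → b < n →
            (∀ k → k < a → f k ≈ 0#) → (∀ k → b < k → f k ≈ 0#) →
            ∑[ a , b ] f ≈ ∑< n f
  ∑[,]≈∑< a b {n} f b<n below above = begin
    ∑[ a , b ] f                                         ≡⟨ ≡.cong (foldr _∙_ 0#) (map-applyUpTo (a ℕ.+_) f (suc b ∸ a)) ⟩
    foldr _∙_ 0# (applyUpTo (f ∘ (a ℕ.+_)) (suc b ∸ a))   ≈⟨ foldr-applyUpTo _ (suc b ∸ a) ⟩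
    ∑< (suc b ∸ a) (f ∘ (a ℕ.+_))                        ≈⟨ ∑<-drop a (suc b) below ⟨
    ∑< (suc b) f                                         ≈⟨ ∑<-extend b<n above ⟩
    ∑< n f                                               ∎

module ℕΣ = RangeSum ℕ.+-0-commutativeMonoid

module BinomialTransform {c ℓ} (R : CommutativeSemiring c ℓ) where
  open CommutativeSemiring R
  open Algebra.Properties.Semiring.Sum semiring using (sum; ∑-distrib-+; *-distribˡ-sum; ∑-comm)
  open Algebra.Properties.Semiring.Mult semiring
  open Algebra.Properties.CommutativeMonoid.Mult +-commutativeMonoid using (×-distrib-+)
  open Algebra.Properties.Semiring.Exp semiring
  open RangeSum +-commutativeMonoid public
  open Algebra.Properties.CommutativeSemigroup +-commutativeSemigroup using () renaming (x∙yz≈y∙xz to x+[y+z]≈y+[x+z])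
  open Algebra.Properties.CommutativeSemigroup *-commutativeSemigroup using () renaming (x∙yz≈y∙xz to x*yz≈y*xz)
  open Relation.Binary.Reasoning.Setoid setoid

  ×-zeroʳ : ∀ c → c × 0# ≈ 0#
  ×-zeroʳ zero    = refl
  ×-zeroʳ (suc c) = trans (+-identityˡ _) (×-zeroʳ c)

  opaque
    unfolding ∑<

    ∑<-+ : ∀ n (f g : ℕ → Carrier) → ∑< n (λ k → f k + g k) ≈ ∑< n f + ∑< n g
    ∑<-+ n f g = ∑-distrib-+ {n} (f ∘ toℕ) (g ∘ toℕ)

    *-∑< : ∀ x n (f : ℕ → Carrier) → x * ∑< n f ≈ ∑< n (λ k → x * f k)
    *-∑< x n f = *-distribˡ-sum {n} x (f ∘ toℕ)

    ∑<-comm : ∀ m n (f : ℕ → ℕ → Carrier) →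
              ∑< m (λ j → ∑< n (λ k → f j k)) ≈ ∑< n (λ k → ∑< m (λ j → f j k))
    ∑<-comm m n f = ∑-comm {m} {n} (λ j k → f (toℕ j) (toℕ k))

    ×-∑< : ∀ c n (f : ℕ → Carrier) → c × ∑< n f ≈ ∑< n (λ k → c × f k)
    ×-∑< c zero    f = ×-zeroʳ c
    ×-∑< c (suc n) f = trans (×-distrib-+ _ _ c) (+-congˡ (×-∑< c n (f ∘ suc)))

    ∑<-× : ∀ n (c : ℕ → ℕ) x → ∑< n (λ k → c k × x) ≈ ℕΣ.∑< n c × x
    ∑<-× zero    c x = refl
    ∑<-× (suc n) c x = trans (+-congˡ (∑<-× n (c ∘ suc) x)) (sym (×-homo-+ x (c 0) _))

  -- The transform `B_x(f)(n)`. Formally, on exponential generating functions in z it is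
  -- multiplication by exp(xz).
  binom : Carrier → ℕ → (ℕ → Carrier) → Carrier
  binom x n f = ∑< (suc n) λ k → (n C k) × (x ^ (n ∸ k) * f k)

  binom-cong : ∀ x n {f g : ℕ → Carrier} → (∀ k → k ≤ n → f k ≈ g k) → binom x n f ≈ binom x n g
  binom-cong x n f≈g = ∑<-cong (suc n) λ { k (s≤s k≤n) → ×-congʳ (n C k) (*-congˡ (f≈g k k≤n)) }

  binom-congˡ : ∀ {x y} n f → x ≈ y → binom x n f ≈ binom y n f
  binom-congˡ n f x≈y = ∑<-cong (suc n) λ k _ → ×-congʳ (n C k) (*-congʳ (^-congˡ (n ∸ k) x≈y))

  binom-+ : ∀ x n (f g : ℕ → Carrier) → binom x n (λ k → f k + g k) ≈ binom x n f + binom x n g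
  binom-+ x n f g = trans
    (∑<-cong (suc n) λ k _ → trans (×-congʳ (n C k) (distribˡ _ _ _)) (×-distrib-+ _ _ (n C k)))
    (∑<-+ (suc n) _ _)

  binom-* : ∀ x n y (f : ℕ → Carrier) → binom x n (λ k → y * f k) ≈ y * binom x n f
  binom-* x n y f = sym (trans (*-∑< y (suc n) _)
    (∑<-cong (suc n) λ k _ → trans (×-comm-* (n C k) y _) (×-congʳ (n C k) (x*yz≈y*xz y _ _))))

  -- After the term `k = 0` is split off, Pascal's rule divides each remaining coefficient in two.
  -- The part with `n C k` is the transform of `f ∘ suc`. The part with `n C suc k` and the
  -- split-off term together form the transform of `f`, with one more factor `x` in every term.
  binom-suc : ∀ x n f → binom x (suc n) f ≈ x * binom x n f + binom x n (f ∘ suc)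
  binom-suc x n f = begin
    binom x (suc n) f
      ≈⟨ ∑<-suc (suc n) _ ⟩
    1 × (x ^ suc n * f 0) + ∑< (suc n) (λ k → (suc n C suc k) × (x ^ (n ∸ k) * f (suc k)))
      ≈⟨ +-congˡ (trans (∑<-cong (suc n) λ k _ → pascal k) (∑<-+ (suc n) _ _)) ⟩
    1 × (x ^ suc n * f 0) + (binom x n (f ∘ suc) + ∑< (suc n) (λ k → (n C suc k) × (x ^ (n ∸ k) * f (suc k))))
      ≈⟨ x+[y+z]≈y+[x+z] _ _ _ ⟩
    binom x n (f ∘ suc) + (1 × (x ^ suc n * f 0) + ∑< (suc n) (λ k → (n C suc k) × (x ^ (n ∸ k) * f (suc k))))
      ≈⟨ +-congˡ (∑<-suc (suc n) _) ⟨
    binom x n (f ∘ suc) + ∑< (suc (suc n)) (λ k → (n C k) × (x ^ (suc n ∸ k) * f k))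
      ≈⟨ +-comm _ _ ⟩
    ∑< (suc (suc n)) (λ k → (n C k) × (x ^ (suc n ∸ k) * f k)) + binom x n (f ∘ suc)
      -- The top term `k = suc n` carries the coefficient `n C suc n`, which is 0.
      ≈⟨ +-congʳ (∑<-extend (ℕ.n≤1+n (suc n)) λ k n<k → ×-congˡ (k>n⇒nCk≡0 n<k)) ⟨
    ∑< (suc n) (λ k → (n C k) × (x ^ (suc n ∸ k) * f k)) + binom x n (f ∘ suc)
      ≈⟨ +-congʳ (∑<-cong (suc n) λ { k (s≤s k≤n) → scale k k≤n }) ⟩
    ∑< (suc n) (λ k → x * ((n C k) × (x ^ (n ∸ k) * f k))) + binom x n (f ∘ suc)
      ≈⟨ +-congʳ (*-∑< x (suc n) _) ⟨
    x * binom x n f + binom x n (f ∘ suc) ∎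
    where
    pascal : ∀ k → (suc n C suc k) × (x ^ (n ∸ k) * f (suc k)) ≈
                   (n C k) × (x ^ (n ∸ k) * f (suc k)) + (n C suc k) × (x ^ (n ∸ k) * f (suc k))
    pascal k = trans (×-congˡ (≡.sym (nCk+nC[k+1]≡[n+1]C[k+1] n k))) (×-homo-+ _ (n C k) (n C suc k))
    scale : ∀ k → k ≤ n → (n C k) × (x ^ (suc n ∸ k) * f k) ≈ x * ((n C k) × (x ^ (n ∸ k) * f k))
    scale k k≤n rewrite ℕ.+-∸-assoc 1 k≤n =
      trans (×-congʳ (n C k) (*-assoc x _ _)) (sym (×-comm-* (n C k) x _))

  binom-0 : ∀ x f → binom x 0 f ≈ f 0
  binom-0 x f = begin
    binom x 0 f                     ≈⟨ ∑<-suc 0 _ ⟩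
    1 × (1# * f 0) + ∑< 0 _         ≈⟨ +-cong (trans (+-identityʳ _) (*-identityˡ _)) (∑<-empty _) ⟩
    f 0 + 0#                        ≈⟨ +-identityʳ _ ⟩
    f 0                             ∎

  -- The induction on `n` keeps `f` arbitrary, because the hypothesis is applied both to `f` and to
  -- `f ∘ suc`.
  binom-binom : ∀ x y n f → binom x n (λ m → binom y m f) ≈ binom (x + y) n f
  binom-binom x y zero    f = trans (binom-0 x _) (trans (binom-0 y f) (sym (binom-0 (x + y) f)))
  binom-binom x y (suc n) f = begin
    binom x (suc n) (λ m → binom y m f)
      ≈⟨ binom-suc x n _ ⟩
    x * binom x n (λ m → binom y m f) + binom x n (λ m → binom y (suc m) f)
      ≈⟨ +-congˡ (binom-cong x n λ m _ → binom-suc y m f) ⟩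
    x * binom x n (λ m → binom y m f) + binom x n (λ m → y * binom y m f + binom y m (f ∘ suc))
      ≈⟨ +-congˡ (trans (binom-+ x n _ _) (+-congʳ (binom-* x n y _))) ⟩
    x * binom x n (λ m → binom y m f) + (y * binom x n (λ m → binom y m f) + binom x n (λ m → binom y m (f ∘ suc)))
      ≈⟨ trans (sym (+-assoc _ _ _)) (+-congʳ (sym (distribʳ _ x y))) ⟩
    (x + y) * binom x n (λ m → binom y m f) + binom x n (λ m → binom y m (f ∘ suc))
      ≈⟨ +-cong (*-congˡ (binom-binom x y n f)) (binom-binom x y n (f ∘ suc)) ⟩
    (x + y) * binom (x + y) n f + binom (x + y) n (f ∘ suc)
      ≈⟨ binom-suc (x + y) n f ⟨
    binom (x + y) (suc n) f ∎

  1^n≈1 : ∀ n → 1# ^ n ≈ 1#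
  1^n≈1 zero    = refl
  1^n≈1 (suc n) = trans (*-identityˡ _) (1^n≈1 n)

  binom-1 : ∀ n f → binom 1# n f ≈ ∑< (suc n) (λ k → (n C k) × f k)
  binom-1 n f = ∑<-cong (suc n) λ k _ →
    ×-congʳ (n C k) (trans (*-congʳ (1^n≈1 (n ∸ k))) (*-identityˡ (f k)))

  -- e k ∸ 2 * i is the degree left for y once x ^ i is chosen; multiplying by
  -- y ^ (n ∸ k) raises it to e n ∸ 2 * i.
  binom-∑< : ∀ x y n N (ξ : ℕ → ℕ → ℕ) (e : ℕ → ℕ) →
    (∀ k i → k ≤ n → ξ k i ≡ 0 ⊎ (n ∸ k) ℕ.+ (e k ∸ 2 ℕ.* i) ≡ e n ∸ 2 ℕ.* i) →
    binom y n (λ k → ∑< N λ i → ξ k i × (x ^ i * y ^ (e k ∸ 2 ℕ.* i))) ≈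
    ∑< N λ i → ℕΣ.∑< (suc n) (λ k → (n C k) ℕ.* ξ k i) × (x ^ i * y ^ (e n ∸ 2 ℕ.* i))
  binom-∑< x y n N ξ e vanish = begin
    binom y n (λ k → ∑< N λ i → ξ k i × (x ^ i * y ^ (e k ∸ 2 ℕ.* i)))
      ≈⟨ ∑<-cong (suc n) (λ k _ → trans (×-congʳ (n C k) (*-∑< _ N _)) (×-∑< (n C k) N _)) ⟩
    ∑< (suc n) (λ k → ∑< N λ i → (n C k) × (y ^ (n ∸ k) * (ξ k i × (x ^ i * y ^ (e k ∸ 2 ℕ.* i)))))
      ≈⟨ ∑<-cong (suc n) (λ { k (s≤s k≤n) → ∑<-cong N λ i _ → term k i k≤n }) ⟩
    ∑< (suc n) (λ k → ∑< N λ i → ((n C k) ℕ.* ξ k i) × (x ^ i * y ^ (e n ∸ 2 ℕ.* i)))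
      ≈⟨ ∑<-comm (suc n) N _ ⟩
    ∑< N (λ i → ∑< (suc n) λ k → ((n C k) ℕ.* ξ k i) × (x ^ i * y ^ (e n ∸ 2 ℕ.* i)))
      ≈⟨ ∑<-cong N (λ i _ → ∑<-× (suc n) _ _) ⟩
    ∑< N (λ i → ℕΣ.∑< (suc n) (λ k → (n C k) ℕ.* ξ k i) × (x ^ i * y ^ (e n ∸ 2 ℕ.* i))) ∎
    where
    shift : ∀ k i → k ≤ n → y ^ (n ∸ k) * (ξ k i × (x ^ i * y ^ (e k ∸ 2 ℕ.* i))) ≈
                            ξ k i × (x ^ i * y ^ (e n ∸ 2 ℕ.* i))
    shift k i k≤n with vanish k i k≤n
    -- Truncated subtraction may have spoilt the exponents here, but both sides are zero.
    ... | inj₁ ξ≡0 rewrite ξ≡0 = zeroʳ _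
    ... | inj₂ eq = begin
      y ^ (n ∸ k) * (ξ k i × (x ^ i * y ^ (e k ∸ 2 ℕ.* i)))    ≈⟨ ×-comm-* (ξ k i) _ _ ⟩
      ξ k i × (y ^ (n ∸ k) * (x ^ i * y ^ (e k ∸ 2 ℕ.* i)))    ≈⟨ ×-congʳ (ξ k i) (x*yz≈y*xz _ _ _) ⟩
      ξ k i × (x ^ i * (y ^ (n ∸ k) * y ^ (e k ∸ 2 ℕ.* i)))    ≈⟨ ×-congʳ (ξ k i) (*-congˡ (sym (^-homo-* y (n ∸ k) _))) ⟩
      ξ k i × (x ^ i * y ^ (n ∸ k ℕ.+ (e k ∸ 2 ℕ.* i)))        ≈⟨ ×-congʳ (ξ k i) (*-congˡ (^-congʳ y eq)) ⟩
      ξ k i × (x ^ i * y ^ (e n ∸ 2 ℕ.* i))                    ∎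
    term : ∀ k i → k ≤ n → (n C k) × (y ^ (n ∸ k) * (ξ k i × (x ^ i * y ^ (e k ∸ 2 ℕ.* i)))) ≈
                           ((n C k) ℕ.* ξ k i) × (x ^ i * y ^ (e n ∸ 2 ℕ.* i))
    term k i k≤n = trans (×-congʳ (n C k) (shift k i k≤n)) (×-assocˡ _ (n C k) (ξ k i))

open import Data.Nat.Base
open import Data.Nat.ListAction using (sum)
open import Data.Nat.ListAction.Properties using (sum-++)
open import Data.Nat.Properties
open import Data.Product using (_×_; _,_; proj₁; proj₂)
open import Relation.Binary.PropositionalEquality hiding ([_])

-- The semiring of polynomials

module ℕ₊ = Algebra.Properties.CommutativeSemigroup +-commutativeSemigroup

coeff-+ : ∀ p q k → coeff (p +ᵖ q) k ≡ coeff p k + coeff q k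
coeff-+ []      q       k       = refl
coeff-+ (a ∷ p) []      k       = sym (+-identityʳ _)
coeff-+ (a ∷ p) (b ∷ q) zero    = refl
coeff-+ (a ∷ p) (b ∷ q) (suc k) = coeff-+ p q k

coeff-map-* : ∀ a p k → coeff (List.map (a *_) p) k ≡ a * coeff p k
coeff-map-* a []      k       = sym (*-zeroʳ a)
coeff-map-* a (b ∷ p) zero    = refl
coeff-map-* a (b ∷ p) (suc k) = coeff-map-* a p k

∷-cong : ∀ a {p q} → p ≈ᵖ q → a ∷ p ≈ᵖ a ∷ q
∷-cong a p≈q zero    = refl
∷-cong a p≈q (suc k) = p≈q k

0∷-+ : ∀ p q → 0 ∷ (p +ᵖ q) ≈ᵖ (0 ∷ p) +ᵖ (0 ∷ q)
0∷-+ p q zero    = refl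
0∷-+ p q (suc k) = refl

-- The rule (a + t p) q = a q + t (p q), read coefficientwise. The laws of the product are reduced
-- to it.
coeff-∷-* : ∀ a p q k → coeff ((a ∷ p) *ᵖ q) k ≡ a * coeff q k + coeff (0 ∷ p *ᵖ q) k
coeff-∷-* a p q k = trans (coeff-+ (List.map (a *_) q) _ k)
                          (cong (_+ coeff (0 ∷ p *ᵖ q) k) (coeff-map-* a q k))

*ᵖ-zeroʳ : ∀ p → p *ᵖ [] ≈ᵖ []
*ᵖ-zeroʳ []      k       = refl
*ᵖ-zeroʳ (a ∷ p) zero    = refl
*ᵖ-zeroʳ (a ∷ p) (suc k) = *ᵖ-zeroʳ p k

-- The mirror image p (b + t q) = b p + t (p q). With both rules, commutativity is an induction on
-- the left factor alone.
coeff-*-∷ : ∀ p b q k → coeff (p *ᵖ (b ∷ q)) k ≡ b * coeff p k + coeff (0 ∷ p *ᵖ q) k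
coeff-*-∷ []      b q zero    = cong (_+ 0) (sym (*-zeroʳ b))
coeff-*-∷ []      b q (suc k) = cong (_+ 0) (sym (*-zeroʳ b))
coeff-*-∷ (a ∷ p) b q zero    = cong (_+ 0) (*-comm a b)
coeff-*-∷ (a ∷ p) b q (suc k) = begin
  coeff ((a ∷ p) *ᵖ (b ∷ q)) (suc k)                        ≡⟨ coeff-∷-* a p (b ∷ q) (suc k) ⟩
  a * coeff q k + coeff (p *ᵖ (b ∷ q)) k                    ≡⟨ cong (a * coeff q k +_) (coeff-*-∷ p b q k) ⟩
  a * coeff q k + (b * coeff p k + coeff (0 ∷ p *ᵖ q) k)    ≡⟨ ℕ₊.x∙yz≈y∙xz (a * coeff q k) (b * coeff p k) _ ⟩
  b * coeff p k + (a * coeff q k + coeff (0 ∷ p *ᵖ q) k)    ≡⟨ cong (b * coeff p k +_) (coeff-∷-* a p q k) ⟨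
  b * coeff p k + coeff ((a ∷ p) *ᵖ q) k                    ∎
  where open ≡-Reasoning

*ᵖ-comm : ∀ p q → p *ᵖ q ≈ᵖ q *ᵖ p
*ᵖ-comm []      q k = sym (*ᵖ-zeroʳ q k)
*ᵖ-comm (a ∷ p) q k = begin
  coeff ((a ∷ p) *ᵖ q) k                  ≡⟨ coeff-∷-* a p q k ⟩
  a * coeff q k + coeff (0 ∷ p *ᵖ q) k    ≡⟨ cong (a * coeff q k +_) (∷-cong 0 (*ᵖ-comm p q) k) ⟩
  a * coeff q k + coeff (0 ∷ q *ᵖ p) k    ≡⟨ coeff-*-∷ q a p k ⟨
  coeff (q *ᵖ (a ∷ p)) k                  ∎
  where open ≡-Reasoning

*ᵖ-congˡ : ∀ p {q q′} → q ≈ᵖ q′ → p *ᵖ q ≈ᵖ p *ᵖ q′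
*ᵖ-congˡ []      q≈ k = refl
*ᵖ-congˡ (a ∷ p) {q} {q′} q≈ k = begin
  coeff ((a ∷ p) *ᵖ q) k                   ≡⟨ coeff-∷-* a p q k ⟩
  a * coeff q k + coeff (0 ∷ p *ᵖ q) k     ≡⟨ cong₂ _+_ (cong (a *_) (q≈ k)) (∷-cong 0 (*ᵖ-congˡ p q≈) k) ⟩
  a * coeff q′ k + coeff (0 ∷ p *ᵖ q′) k   ≡⟨ coeff-∷-* a p q′ k ⟨
  coeff ((a ∷ p) *ᵖ q′) k                  ∎
  where open ≡-Reasoning

-- Lists of different lengths can be equal under `≈ᵖ`, so the left factor is not changed by a joint
-- induction on `p` and `p′`; commutativity moves it to the right first.
*ᵖ-cong : ∀ {p p′ q q′} → p ≈ᵖ p′ → q ≈ᵖ q′ → p *ᵖ q ≈ᵖ p′ *ᵖ q′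
*ᵖ-cong {p} {p′} {q} {q′} p≈ q≈ k = begin
  coeff (p *ᵖ q) k     ≡⟨ *ᵖ-congˡ p q≈ k ⟩
  coeff (p *ᵖ q′) k    ≡⟨ *ᵖ-comm p q′ k ⟩
  coeff (q′ *ᵖ p) k    ≡⟨ *ᵖ-congˡ q′ p≈ k ⟩
  coeff (q′ *ᵖ p′) k   ≡⟨ *ᵖ-comm q′ p′ k ⟩
  coeff (p′ *ᵖ q′) k   ∎
  where open ≡-Reasoning

+ᵖ-cong : ∀ {p p′ q q′} → p ≈ᵖ p′ → q ≈ᵖ q′ → p +ᵖ q ≈ᵖ p′ +ᵖ q′
+ᵖ-cong {p} {p′} {q} {q′} p≈ q≈ k =
  trans (coeff-+ p q k) (trans (cong₂ _+_ (p≈ k) (q≈ k)) (sym (coeff-+ p′ q′ k)))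

+ᵖ-assoc : ∀ p q r → (p +ᵖ q) +ᵖ r ≈ᵖ p +ᵖ (q +ᵖ r)
+ᵖ-assoc p q r k
  rewrite coeff-+ (p +ᵖ q) r k | coeff-+ p q k | coeff-+ p (q +ᵖ r) k | coeff-+ q r k
  = +-assoc (coeff p k) (coeff q k) (coeff r k)

+ᵖ-comm : ∀ p q → p +ᵖ q ≈ᵖ q +ᵖ p
+ᵖ-comm p q k rewrite coeff-+ p q k | coeff-+ q p k = +-comm (coeff p k) (coeff q k)

*ᵖ-distribʳ : ∀ r p q → (p +ᵖ q) *ᵖ r ≈ᵖ p *ᵖ r +ᵖ q *ᵖ r
*ᵖ-distribʳ r []      q       k = refl
*ᵖ-distribʳ r (a ∷ p) []      k = sym (trans (coeff-+ ((a ∷ p) *ᵖ r) [] k) (+-identityʳ _))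
*ᵖ-distribʳ r (a ∷ p) (b ∷ q) k = begin
  coeff ((a + b ∷ p +ᵖ q) *ᵖ r) k
    ≡⟨ coeff-∷-* (a + b) (p +ᵖ q) r k ⟩
  (a + b) * rₖ + coeff (0 ∷ (p +ᵖ q) *ᵖ r) k
    ≡⟨ cong₂ _+_ (*-distribʳ-+ rₖ a b) (∷-cong 0 (*ᵖ-distribʳ r p q) k) ⟩
  a * rₖ + b * rₖ + coeff (0 ∷ (p *ᵖ r +ᵖ q *ᵖ r)) k
    ≡⟨ cong (a * rₖ + b * rₖ +_) (trans (0∷-+ (p *ᵖ r) (q *ᵖ r) k) (coeff-+ (0 ∷ p *ᵖ r) (0 ∷ q *ᵖ r) k)) ⟩
  a * rₖ + b * rₖ + (coeff (0 ∷ p *ᵖ r) k + coeff (0 ∷ q *ᵖ r) k)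
    ≡⟨ ℕ₊.interchange (a * rₖ) (b * rₖ) _ _ ⟩
  a * rₖ + coeff (0 ∷ p *ᵖ r) k + (b * rₖ + coeff (0 ∷ q *ᵖ r) k)
    ≡⟨ cong₂ _+_ (coeff-∷-* a p r k) (coeff-∷-* b q r k) ⟨
  coeff ((a ∷ p) *ᵖ r) k + coeff ((b ∷ q) *ᵖ r) k
    ≡⟨ coeff-+ ((a ∷ p) *ᵖ r) _ k ⟨
  coeff ((a ∷ p) *ᵖ r +ᵖ (b ∷ q) *ᵖ r) k ∎
  where
  open ≡-Reasoning
  rₖ = coeff r k

map-*-*ᵖ : ∀ a p q → List.map (a *_) p *ᵖ q ≈ᵖ List.map (a *_) (p *ᵖ q)
map-*-*ᵖ a []      q k = refl
map-*-*ᵖ a (b ∷ p) q k = begin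
  coeff ((a * b ∷ List.map (a *_) p) *ᵖ q) k
    ≡⟨ coeff-∷-* (a * b) (List.map (a *_) p) q k ⟩
  a * b * coeff q k + coeff (0 ∷ List.map (a *_) p *ᵖ q) k
    ≡⟨ cong₂ _+_ (*-assoc a b _) (trans (∷-cong 0 {List.map (a *_) p *ᵖ q} (map-*-*ᵖ a p q) k) (shift k)) ⟩
  a * (b * coeff q k) + a * coeff (0 ∷ p *ᵖ q) k
    ≡⟨ *-distribˡ-+ a _ _ ⟨
  a * (b * coeff q k + coeff (0 ∷ p *ᵖ q) k)
    ≡⟨ cong (a *_) (coeff-∷-* b p q k) ⟨
  a * coeff ((b ∷ p) *ᵖ q) k
    ≡⟨ coeff-map-* a ((b ∷ p) *ᵖ q) k ⟨
  coeff (List.map (a *_) ((b ∷ p) *ᵖ q)) k ∎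
  where
  open ≡-Reasoning
  shift : ∀ k → coeff (0 ∷ List.map (a *_) (p *ᵖ q)) k ≡ a * coeff (0 ∷ p *ᵖ q) k
  shift zero    = sym (*-zeroʳ a)
  shift (suc k) = coeff-map-* a (p *ᵖ q) k

-- Distributivity splits the left factor a q + t (p q): the scalar a leaves the product by
-- `map-*-*ᵖ`, and the factor t leaves it by `coeff-∷-*`, exposing the induction hypothesis.
*ᵖ-assoc : ∀ p q r → (p *ᵖ q) *ᵖ r ≈ᵖ p *ᵖ (q *ᵖ r)
*ᵖ-assoc []      q r k = refl
*ᵖ-assoc (a ∷ p) q r k = begin
  coeff ((List.map (a *_) q +ᵖ (0 ∷ p *ᵖ q)) *ᵖ r) k
    ≡⟨ *ᵖ-distribʳ r (List.map (a *_) q) (0 ∷ p *ᵖ q) k ⟩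
  coeff (List.map (a *_) q *ᵖ r +ᵖ (0 ∷ p *ᵖ q) *ᵖ r) k
    ≡⟨ coeff-+ (List.map (a *_) q *ᵖ r) _ k ⟩
  coeff (List.map (a *_) q *ᵖ r) k + coeff ((0 ∷ p *ᵖ q) *ᵖ r) k
    ≡⟨ cong₂ _+_ (trans (map-*-*ᵖ a q r k) (coeff-map-* a (q *ᵖ r) k))
                 (trans (coeff-∷-* 0 (p *ᵖ q) r k) (∷-cong 0 (*ᵖ-assoc p q r) k)) ⟩
  a * coeff (q *ᵖ r) k + coeff (0 ∷ p *ᵖ (q *ᵖ r)) k
    ≡⟨ coeff-∷-* a p (q *ᵖ r) k ⟨
  coeff ((a ∷ p) *ᵖ (q *ᵖ r)) k ∎
  where open ≡-Reasoning

*ᵖ-identityˡ : ∀ p → 1ᵖ *ᵖ p ≈ᵖ p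
*ᵖ-identityˡ p k = begin
  coeff (1ᵖ *ᵖ p) k                  ≡⟨ coeff-∷-* 1 [] p k ⟩
  1 * coeff p k + coeff (0 ∷ []) k   ≡⟨ cong₂ _+_ (*-identityˡ _) (coeff-0∷[] k) ⟩
  coeff p k + 0                      ≡⟨ +-identityʳ _ ⟩
  coeff p k                          ∎
  where
  open ≡-Reasoning
  coeff-0∷[] : ∀ k → coeff (0 ∷ []) k ≡ 0
  coeff-0∷[] zero    = refl
  coeff-0∷[] (suc k) = refl

-- Built on the operations of `polyRawSemiring`, so that its powers and multiples are `_^ᵖ_` and
-- `_·ᵖ_` definitionally.
polyCommutativeSemiring : CommutativeSemiring 0ℓ 0ℓ
polyCommutativeSemiring = record
  { Carrier = Poly
  ; _≈_     = _≈ᵖ_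
  ; _+_     = _+ᵖ_
  ; _*_     = _*ᵖ_
  ; 0#      = []
  ; 1#      = 1ᵖ
  ; isCommutativeSemiring = IsCommutativeSemiringˡ.isCommutativeSemiring record
    { +-isCommutativeMonoid = record
      { isMonoid = record
        { isSemigroup = record
          { isMagma = record
            { isEquivalence = isEquivalence-≈ᵖ
            ; ∙-cong        = λ {p} {p′} {q} {q′} → +ᵖ-cong {p} {p′} {q} {q′}
            }
          ; assoc = +ᵖ-assoc
          }
        ; identity = (λ p k → refl) , (λ p k → trans (coeff-+ p [] k) (+-identityʳ _))
        }
      ; comm = +ᵖ-comm
      }
    ; *-isCommutativeMonoid = record
      { isMonoid = record
        { isSemigroup = record
          { isMagma = record
            { isEquivalence = isEquivalence-≈ᵖ
            ; ∙-cong        = λ {p} {p′} {q} {q′} → *ᵖ-cong {p} {p′} {q} {q′}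
            }
          ; assoc = *ᵖ-assoc
          }
        ; identity = *ᵖ-identityˡ , (λ p k → trans (*ᵖ-comm p 1ᵖ k) (*ᵖ-identityˡ p k))
        }
      ; comm = *ᵖ-comm
      }
    ; distribʳ = *ᵖ-distribʳ
    ; zeroˡ = λ p k → refl
    }
  }
  where
  isEquivalence-≈ᵖ : IsEquivalence _≈ᵖ_
  isEquivalence-≈ᵖ = record
    { refl = λ k → refl ; sym = λ e k → sym (e k) ; trans = λ e f k → trans (e k) (f k) }

-- Counting by the first letter

module _ {A B D : Set} {P : Pred D 0ℓ} (P? : Decidable P) (f : A → B → D) where

  length-filter-map : ∀ x ys → length (filter P? (List.map (f x) ys)) ≡
                               length (filter (P? ∘ f x) ys)
  length-filter-map x []       = refl
  length-filter-map x (y ∷ ys) with does (P? (f x y))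
  ... | true  = cong suc (length-filter-map x ys)
  ... | false = length-filter-map x ys

  length-filter-cartesianProductWith : ∀ xs ys →
    length (filter P? (cartesianProductWith f xs ys)) ≡
    sum (List.map (λ x → length (filter (P? ∘ f x) ys)) xs)
  length-filter-cartesianProductWith []       ys = refl
  length-filter-cartesianProductWith (x ∷ xs) ys
    rewrite filter-++ P? (List.map (f x) ys) (cartesianProductWith f xs ys)
          | length-++ (filter P? (List.map (f x) ys)) {filter P? (cartesianProductWith f xs ys)}
    = cong₂ _+_ (length-filter-map x ys) (length-filter-cartesianProductWith xs ys)

sum-cartesianProductWith : ∀ {A B D : Set} (g : D → ℕ) (f : A → B → D) xs ys →
  sum (List.map g (cartesianProductWith f xs ys)) ≡
  sum (List.map (λ x → sum (List.map (g ∘ f x) ys)) xs)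
sum-cartesianProductWith g f []       ys = refl
sum-cartesianProductWith g f (x ∷ xs) ys
  rewrite map-++ g (List.map (f x) ys) (cartesianProductWith f xs ys)
        | sum-++ (List.map g (List.map (f x) ys)) (List.map g (cartesianProductWith f xs ys))
  = cong₂ _+_ (cong sum (sym (map-∘ ys))) (sum-cartesianProductWith g f xs ys)

sum-map-zero : ∀ {A : Set} {g : A → ℕ} → (∀ x → g x ≡ 0) → ∀ xs → sum (List.map g xs) ≡ 0
sum-map-zero g≡0 []       = refl
sum-map-zero g≡0 (x ∷ xs) = cong₂ _+_ (g≡0 x) (sum-map-zero g≡0 xs)

sum-allFin-suc : ∀ n (g : Fin (suc n) → ℕ) →
                 sum (List.map g (allFin (suc n))) ≡ g zero + sum (List.map (g ∘ suc) (allFin n))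
sum-allFin-suc n g = cong (λ ns → g zero + sum ns)
  (trans (map-tabulate suc g) (sym (map-tabulate id (g ∘ suc))))

sum-allFin-single : ∀ {n} (g : Fin n → ℕ) j → (∀ i → i ≢ j → g i ≡ 0) →
                    sum (List.map g (allFin n)) ≡ g j
sum-allFin-single {suc n} g zero    g≡0 = trans (sum-allFin-suc n g)
  (trans (cong (g zero +_) (sum-map-zero (λ i → g≡0 (suc i) λ ()) (allFin n))) (+-identityʳ _))
sum-allFin-single {suc n} g (suc j) g≡0 = trans (sum-allFin-suc n g)
  (cong₂ _+_ (g≡0 zero λ ())
             (sum-allFin-single (g ∘ suc) j λ i i≢j → g≡0 (suc i) (i≢j ∘ Fin.suc-injective)))

module _ {A : Set} {P Q R : Pred A 0ℓ}
         (P? : Decidable P) (Q? : Decidable Q) (R? : Decidable R) where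

  length-filter-⊎ : (∀ x → R x ⇔ (P x ⊎ Q x)) → (∀ x → P x → ¬ Q x) → ∀ xs →
    length (filter R? xs) ≡ length (filter P? xs) + length (filter Q? xs)
  length-filter-⊎ R⇔ P⊥Q []       = refl
  length-filter-⊎ R⇔ P⊥Q (x ∷ xs) with ih ← length-filter-⊎ R⇔ P⊥Q xs | R? x | P? x | Q? x
  ... | yes r | yes p | yes q = contradiction q (P⊥Q x p)
  ... | yes r | yes p | no ¬q = cong suc ih
  ... | yes r | no ¬p | yes q = trans (cong suc ih) (sym (+-suc _ _))
  ... | yes r | no ¬p | no ¬q with Equivalence.to (R⇔ x) r
  ...   | inj₁ p = contradiction p ¬p
  ...   | inj₂ q = contradiction q ¬q
  length-filter-⊎ R⇔ P⊥Q (x ∷ xs) | no ¬r | yes p | _     = contradiction (Equivalence.from (R⇔ x) (inj₁ p)) ¬r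
  length-filter-⊎ R⇔ P⊥Q (x ∷ xs) | no ¬r | no ¬p | yes q = contradiction (Equivalence.from (R⇔ x) (inj₂ q)) ¬r
  length-filter-⊎ R⇔ P⊥Q (x ∷ xs) | no ¬r | no ¬p | no ¬q = ih

count-cong : ∀ {r n} {P Q : Pred (ColoredPerm r n) 0ℓ} (P? : Decidable P) (Q? : Decidable Q) →
             (∀ w → P w ⇔ Q w) → count P P? ≡ count Q Q?
count-cong {r} {n} P? Q? P⇔Q = cong length
  (filter-≐ P? Q? ((λ {w} → Equivalence.to (P⇔Q w)) , (λ {w} → Equivalence.from (P⇔Q w))) (coloredPerms r n))

count-none : ∀ {r n} {P : Pred (ColoredPerm r n) 0ℓ} (P? : Decidable P) →
             (∀ w → ¬ P w) → count P P? ≡ 0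
count-none {r} {n} P? ¬P = cong length (filter-none P? (All.universal ¬P (coloredPerms r n)))

cons : ∀ {r n} → Fin (suc n) → Fin r → ColoredPerm r n → ColoredPerm r (suc n)
cons j c w = ⟨ Perm.insert zero j (σ w) , c ∷ ε w ⟩

-- The enumeration itself is generated by `Perm.insert zero` and `_∷_`. The count is therefore a
-- nested sum over first value, rest of the permutation, first color and rest of the colors, and
-- only the terms with first value `j` and first color `c` survive.
count-cons : ∀ {r n} {P : Pred (ColoredPerm r (suc n)) 0ℓ} (P? : Decidable P) j c →
             (∀ w → P w → σ w ⟨$⟩ʳ zero ≡ j × head (ε w) ≡ c) →
             count P P? ≡ count (P ∘ cons j c) (P? ∘ cons j c)
count-cons {r} {n} {P} P? j c first = begin
  count P P?
    ≡⟨ length-filter-cartesianProductWith P? ⟨_,_⟩ (permutations (suc n)) (words r (suc n)) ⟩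
  sum (List.map g (permutations (suc n)))
    ≡⟨ sum-cartesianProductWith g (Perm.insert zero) (allFin (suc n)) (permutations n) ⟩
  sum (List.map (λ i → sum (List.map (g ∘ Perm.insert zero i) (permutations n))) (allFin (suc n)))
    ≡⟨ sum-allFin-single _ j (λ i i≢j → sum-map-zero
         (λ π → cong length (filter-none (P? ∘ ⟨ _ ,_⟩) (All.universal (λ e p → i≢j (proj₁ (first _ p))) (words r (suc n)))))
         (permutations n)) ⟩
  sum (List.map (g ∘ Perm.insert zero j) (permutations n))
    ≡⟨ cong sum (map-cong (λ π → trans
         (length-filter-cartesianProductWith (P? ∘ ⟨ Perm.insert zero j π ,_⟩) _∷_ (allFin r) (words r n))
         (sum-allFin-single _ c λ d d≢c → cong length
           (filter-none (P? ∘ ⟨ Perm.insert zero j π ,_⟩ ∘ (d ∷_)) (All.universal (λ e p → d≢c (proj₂ (first _ p))) (words r n)))))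
         (permutations n)) ⟩
  sum (List.map (λ π → length (filter (λ e → P? (cons j c ⟨ π , e ⟩)) (words r n))) (permutations n))
    ≡⟨ length-filter-cartesianProductWith (P? ∘ cons j c) ⟨_,_⟩ (permutations n) (words r n) ⟨
  count (P ∘ cons j c) (P? ∘ cons j c) ∎
  where
  open ≡-Reasoning
  g : Permutation′ (suc n) → ℕ
  g π = length (filter (P? ∘ ⟨ π ,_⟩) (words r (suc n)))

-- The value y of a permutation becomes bump k y when a first letter k is
-- inserted before it.
bump : ℕ → ℕ → ℕ
bump zero    y       = suc y
bump (suc k) zero    = zero
bump (suc k) (suc y) = suc (bump k y)

bump-mono-< : ∀ k {x y} → x < y → bump k x < bump k y
bump-mono-< zero    x<y                       = s≤s x<y
bump-mono-< (suc k) {zero}  {suc y} x<y       = s≤s z≤n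
bump-mono-< (suc k) {suc x} {suc y} (s≤s x<y) = s≤s (bump-mono-< k x<y)

bump-cancel-< : ∀ k {x y} → bump k x < bump k y → x < y
bump-cancel-< zero    (s≤s x<y)                 = x<y
bump-cancel-< (suc k) {zero}  {suc y} _         = s≤s z≤n
bump-cancel-< (suc k) {suc x} {suc y} (s≤s x<y) = s≤s (bump-cancel-< k x<y)

bump-< : ∀ {k y} → y < k → bump k y ≡ y
bump-< {suc k} {zero}  _         = refl
bump-< {suc k} {suc y} (s≤s y<k) = cong suc (bump-< y<k)

bump-≥ : ∀ {k y} → k ≤ y → bump k y ≡ suc y
bump-≥ z≤n       = refl
bump-≥ (s≤s k≤y) = cong suc (bump-≥ k≤y)

bump<⇒< : ∀ {k y} → bump k y < k → y < k
bump<⇒< {suc k} {zero}  _         = s≤s z≤n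
bump<⇒< {suc k} {suc y} (s≤s b<k) = s≤s (bump<⇒< b<k)

-- `bump` extends `punchIn` to all natural numbers, so that it also acts on the appended value n+1,
-- which lies outside the permutation.
toℕ-punchIn : ∀ {n} (j : Fin (suc n)) x → toℕ (punchIn j x) ≡ bump (toℕ j) (toℕ x)
toℕ-punchIn zero    x       = refl
toℕ-punchIn (suc j) zero    = refl
toℕ-punchIn (suc j) (suc x) = cong suc (toℕ-punchIn j x)

-- Ascents and decreasing runs under prepending

module _ {r n} (j : Fin (suc n)) (c : Fin r) (w : ColoredPerm r n) where

  value-cons : ∀ k → value (cons j c w) (suc k) ≡ bump (pos j) (value w k)
  value-cons k = cong suc (toℕ-punchIn j (σ w ⟨$⟩ʳ k))

lookup-∷ʳ-map : ∀ {n} (h : ℕ → ℕ) {f g : Fin n → ℕ} {x y} → (∀ k → f k ≡ h (g k)) → x ≡ h y →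
                ∀ k → lookup (Vec.tabulate f ∷ʳ x) k ≡ h (lookup (Vec.tabulate g ∷ʳ y) k)
lookup-∷ʳ-map {zero}  h f≡ x≡ zero    = x≡
lookup-∷ʳ-map {suc n} h f≡ x≡ zero    = f≡ zero
lookup-∷ʳ-map {suc n} h f≡ x≡ (suc k) = lookup-∷ʳ-map h (f≡ ∘ suc) x≡ k

module _ {r n} (j : Fin (suc n)) (c : Fin r) (w : ColoredPerm r n) where

  lookup-values-cons : ∀ k → lookup (values (cons j c w)) (suc k) ≡ bump (pos j) (lookup (values w) k)
  lookup-values-cons = lookup-∷ʳ-map (bump (pos j)) (value-cons j c w)
    -- The appended value n+1 is at least `pos j`, so it is bumped to n+2, the value appended at the
    -- new length.
    (cong suc (sym (bump-≥ (s≤s⁻¹ (toℕ<n j)))))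

  -- Prepending leaves the later colors alone and changes the later values, including the appended
  -- one, by the strictly increasing map `bump (pos j)`.
  descent-cons : ∀ k → Descent (cons j c w) (suc k) ⇔ Descent w k
  descent-cons k = mk⇔
    (Sum.map₂ λ (e , d) → e , bump-cancel-< (pos j) (subst₂ _<_ (lookup-values-cons (suc k)) (lookup-values-cons (inject₁ k)) d))
    (Sum.map₂ λ (e , d) → e , subst₂ _<_ (sym (lookup-values-cons (suc k))) (sym (lookup-values-cons (inject₁ k))) (bump-mono-< (pos j) d))

  Asc-cons : Asc (cons j c w) ≡ not (does (descent? (cons j c w) zero)) ∷ Asc w
  Asc-cons = cong (λ D → not (does (descent? (cons j c w) zero)) ∷ Vec.map not D)
    (tabulate-cong λ k → does-⇔ (descent-cons k) (descent? (cons j c w) (suc k)) (descent? w k))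

  Asc-cons-descent : Descent (cons j c w) zero → Asc (cons j c w) ≡ outside ∷ Asc w
  Asc-cons-descent d = trans Asc-cons
    (cong (λ b → not b ∷ Asc w) (dec-true (descent? (cons j c w) zero) d))

  Asc-cons-ascent : ¬ Descent (cons j c w) zero → Asc (cons j c w) ≡ inside ∷ Asc w
  Asc-cons-ascent ¬d = trans Asc-cons
    (cong (λ b → not b ∷ Asc w) (dec-false (descent? (cons j c w) zero) ¬d))

-- The prepended letter is minimal in color and in value. For `n = 0` the next entry is the appended
-- value 2, whence the case distinction.
Asc-cons-one : ∀ {r n} (w : ColoredPerm (suc r) n) → Asc (cons zero zero w) ≡ inside ∷ Asc w
Asc-cons-one w = Asc-cons-ascent zero zero w (¬descent w)
  where
  ¬descent : ∀ {r n} (w : ColoredPerm (suc r) n) → ¬ Descent (cons zero zero w) zero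
  ¬descent {n = zero}  w (inj₂ (_ , s≤s ()))
  ¬descent {n = suc n} w (inj₂ (_ , s≤s ()))

decreasingToOne-cons-one : ∀ {r n} (w : ColoredPerm (suc r) n) → DecreasingToOne (cons zero zero w)
decreasingToOne-cons-one w =
  zero , refl , (λ { zero _ → refl }) , λ { j zero () _ ; j (suc k) _ () }

decreasingToOne⇒color₀≡0 : ∀ {r n} (w : ColoredPerm r (suc n)) → DecreasingToOne w → color w zero ≡ 0
decreasingToOne⇒color₀≡0 w (m , _ , c≡0 , _) = c≡0 zero z≤n

module _ {r n} (j : Fin (suc n)) (w : ColoredPerm (suc r) (suc n)) where

  private w′ = cons (suc j) zero w

  -- The new first value is `toℕ j` + 2, whereas the old one is at most `toℕ j` + 1 and is thus not
  -- bumped. Both have color 0, so the first index is a descent.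
  Asc-cons-larger : color w zero ≡ 0 → toℕ (σ w ⟨$⟩ʳ zero) ≤ toℕ j → Asc w′ ≡ outside ∷ Asc w
  Asc-cons-larger c≡0 v≤j = Asc-cons-descent (suc j) zero w
    (inj₂ (sym c≡0 , subst (_< pos (suc j)) (sym (trans (value-cons (suc j) zero w zero) (bump-< v<))) v<))
    where
    v< : value w zero < pos (suc j)
    v< = s≤s (s≤s v≤j)

  -- The run down to 1 in the longer word is the new letter followed by the run of `w`; the decrease
  -- at the junction is the bound on the first letter of `w`.
  decreasingToOne-cons : DecreasingToOne w′ ⇔ (DecreasingToOne w × toℕ (σ w ⟨$⟩ʳ zero) ≤ toℕ j)
  decreasingToOne-cons = mk⇔ to from
    where
    v≡ = value-cons (suc j) zero w
    bump≡1 : ∀ {v} → bump (pos (suc j)) v ≡ 1 → v ≡ 1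
    bump≡1 {suc zero} _ = refl
    to : DecreasingToOne w′ → DecreasingToOne w × toℕ (σ w ⟨$⟩ʳ zero) ≤ toℕ j
    -- The case `m = zero` is impossible: the first value of `w′` is at least 2.
    to (suc m , v≡1 , c≡0 , dec) =
        (m , bump≡1 (trans (sym (v≡ m)) v≡1)
           , (λ i i≤m → c≡0 (suc i) (s≤s i≤m))
           , (λ i k i<k k≤m → bump-cancel-< (pos (suc j))
                (subst₂ _<_ (v≡ k) (v≡ i) (dec (suc i) (suc k) (s≤s i<k) (s≤s k≤m)))))
      , s≤s⁻¹ (s≤s⁻¹ (bump<⇒< (subst (_< pos (suc j)) (v≡ zero) (dec zero (suc zero) (s≤s z≤n) (s≤s z≤n)))))
    from : DecreasingToOne w × toℕ (σ w ⟨$⟩ʳ zero) ≤ toℕ j → DecreasingToOne w′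
    from ((m , v≡1 , c≡0 , dec) , v≤j) =
      suc m , trans (v≡ m) (trans (cong (bump (pos (suc j))) v≡1) refl) , c′ , dec′
      where
      -- All letters of the run are at most its first letter, so they lie below the new letter and
      -- are not bumped.
      bounded : ∀ k → k Fin.≤ m → value w k < pos (suc j)
      bounded zero    k≤m = s≤s (s≤s v≤j)
      bounded (suc k) k≤m = <-trans (dec zero (suc k) (s≤s z≤n) k≤m) (s≤s (s≤s v≤j))
      c′ : ∀ i → i Fin.≤ suc m → color w′ i ≡ 0
      c′ zero    _         = refl
      c′ (suc i) (s≤s i≤m) = c≡0 i i≤m
      dec′ : ∀ i k → i Fin.< k → k Fin.≤ suc m → value w′ i > value w′ k
      dec′ zero    (suc k) _         (s≤s k≤m) =
        subst (_< pos (suc j)) (sym (trans (v≡ k) (bump-< (bounded k k≤m)))) (bounded k k≤m)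
      dec′ (suc i) (suc k) (s≤s i<k) (s≤s k≤m) =
        subst₂ _<_ (sym (v≡ k)) (sym (v≡ i)) (bump-mono-< (pos (suc j)) (dec i k i<k k≤m))

-- Pascal's recurrence for bounded first letters

module ℕB = BinomialTransform +-*-commutativeSemiring
open Equivalence using (to; from)

-- Zero-based: `first w ≤ j` means w(1) ≤ j+1.
first : ∀ {r n} → ColoredPerm r (suc n) → ℕ
first w = toℕ (σ w ⟨$⟩ʳ zero)

-- Statements (i) and (ii) differ only in the condition `Q` on the ascent set. The recurrence asks
-- of `Q` merely that it be insensitive to an initial descent, so both are counted at once. Writing
-- the number of colors as `suc r` makes color 0 available.
module Prepend {r : ℕ} (Q : ∀ {n} → Subset (suc n) → Set) (Q? : ∀ {n} → Decidable (Q {n}))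
  (Q-outside : ∀ {n} {S : Subset (suc n)} → Q (outside ∷ S) ⇔ Q S) where

  Γ : ∀ {n} → ColoredPerm (suc r) (suc n) → Set
  Γ w = Q (Asc w) × DecreasingToOne w

  Γ? : ∀ {n} → Decidable (Γ {n})
  Γ? w = Q? (Asc w) ×-dec decreasingToOne? w

  -- What is left of a word in `Γ` when its first letter 1 is removed; that letter was an ascent,
  -- whence `inside`.
  Base : ∀ {n} → ColoredPerm (suc r) n → Set
  Base v = Q (inside ∷ Asc v)

  base? : ∀ {n} → Decidable (Base {n})
  base? v = Q? (inside ∷ Asc v)

  Γ₁≤ Γ₁≡ : ∀ {n} → ℕ → ColoredPerm (suc r) (suc n) → Set
  Γ₁≤ j w = Γ w × first w ≤ j
  Γ₁≡ j w = Γ w × first w ≡ j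

  Γ₁≤? : ∀ {n} j → Decidable (Γ₁≤ {n} j)
  Γ₁≤? j w = Γ? w ×-dec (first w ≤? j)

  Γ₁≡? : ∀ {n} j → Decidable (Γ₁≡ {n} j)
  Γ₁≡? j w = Γ? w ×-dec (first w ≟ j)

  #base : ℕ → ℕ
  #base n = count {suc r} {n} Base base?

  -- `#first≤ n j` is the T(n,j) of the recurrence.
  #first≤ #first≡ : ℕ → ℕ → ℕ
  #first≤ n j = count {suc r} {suc n} (Γ₁≤ j) (Γ₁≤? j)
  #first≡ n j = count {suc r} {suc n} (Γ₁≡ j) (Γ₁≡? j)

  color₀≡0⇒head≡zero : ∀ {n} (w : ColoredPerm (suc r) (suc n)) → color w zero ≡ 0 → head (ε w) ≡ zero
  color₀≡0⇒head≡zero ⟨ _ , c ∷ _ ⟩ = toℕ-injective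

  -- A word starting with 1 in color 0 is decreasing to 1 with m = 1, whatever follows, and
  -- `DecreasingToOne` forces that color.
  #first≤-zero : ∀ n → #first≤ n 0 ≡ #base n
  #first≤-zero n = trans
    (count-cons (Γ₁≤? {n} 0) zero zero
      λ w ((_ , d) , v≤0) → toℕ-injective (n≤0⇒n≡0 v≤0)
                          , color₀≡0⇒head≡zero w (decreasingToOne⇒color₀≡0 w d))
    (count-cong (λ v → Γ₁≤? {n} 0 (cons zero zero v)) (base? {n}) λ v → mk⇔
      (λ ((q , _) , _) → subst Q (Asc-cons-one v) q)
      (λ q → (subst Q (sym (Asc-cons-one v)) q , decreasingToOne-cons-one v) , z≤n))

  #first≤-suc : ∀ n j → #first≤ n (suc j) ≡ #first≤ n j + #first≡ n (suc j)
  #first≤-suc n j = length-filter-⊎ (Γ₁≤? {n} j) (Γ₁≡? (suc j)) (Γ₁≤? (suc j))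
    (λ w → mk⇔ (λ (γ , v≤1+j) → split w γ (m≤n⇒m<n∨m≡n v≤1+j))
               (λ { (inj₁ (γ , v≤j)) → γ , m≤n⇒m≤1+n v≤j
                  ; (inj₂ (γ , v≡)) → γ , ≤-reflexive v≡ }))
    (λ w (_ , v≤j) (_ , v≡) → <⇒≱ (s≤s v≤j) (≤-reflexive (sym v≡)))
    (coloredPerms (suc r) (suc n))
    where
    split : ∀ w → Γ w → first w < suc j ⊎ first w ≡ suc j →
            (Γ w × first w ≤ j) ⊎ (Γ w × first w ≡ suc j)
    split w γ (inj₁ v<) = inj₁ (γ , s≤s⁻¹ v<)
    split w γ (inj₂ v≡) = inj₂ (γ , v≡)

  -- A first letter with value at least 2 has color 0 and is a descent into the rest of the run.
  -- Removing it preserves `Q`, and the letter that follows it is then subject to the bound `toℕ j`.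
  #first≡-suc : ∀ {n} (j : Fin (suc n)) → #first≡ (suc n) (suc (toℕ j)) ≡ #first≤ n (toℕ j)
  #first≡-suc {n} j = trans
    (count-cons (Γ₁≡? {suc n} (suc (toℕ j))) (suc j) zero
      λ w ((_ , d) , v≡) → toℕ-injective v≡ , color₀≡0⇒head≡zero w (decreasingToOne⇒color₀≡0 w d))
    (count-cong (λ v → Γ₁≡? {suc n} (suc (toℕ j)) (cons (suc j) zero v)) (Γ₁≤? {n} (toℕ j)) λ v → mk⇔
      (λ ((q , d) , _) → let (d′ , v≤j) = to (decreasingToOne-cons j v) d in
        (to Q-outside (subst Q (Asc-cons-larger j v (decreasingToOne⇒color₀≡0 v d′) v≤j) q) , d′) , v≤j)
      (λ ((q , d) , v≤j) →
        ( subst Q (sym (Asc-cons-larger j v (decreasingToOne⇒color₀≡0 v d) v≤j)) (from Q-outside q)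
        , from (decreasingToOne-cons j v) (d , v≤j))
        , refl))

  -- Writing the size as `j + d` keeps the bound `j` within it. The induction is on `j` for all `d`,
  -- because the recurrence leads to `d` and to `suc d`; on the other side this is `binom-suc` at x
  -- = 1.
  #first≤-binom : ∀ j d → #first≤ (j + d) j ≡ ℕB.binom 1 j (λ k → #base (k + d))
  #first≤-binom zero    d = trans (#first≤-zero d) (sym (ℕB.binom-0 1 _))
  #first≤-binom (suc j) d = begin
    #first≤ (suc j + d) (suc j)
      ≡⟨ #first≤-suc (suc j + d) j ⟩
    #first≤ (suc j + d) j + #first≡ (suc j + d) (suc j)
      -- In the first summand the excess of the size over `j` grows to `suc d`. In the second, `j`
      -- is turned into an element of `Fin (suc (j + d))` to serve as a letter.
      ≡⟨ cong₂ _+_ (cong (λ n → #first≤ n j) (sym (+-suc j d)))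
           (subst (λ k → #first≡ (suc j + d) (suc k) ≡ #first≤ (j + d) k)
                  (Fin.toℕ-fromℕ< (s≤s (m≤m+n j d))) (#first≡-suc (Fin.fromℕ< (s≤s (m≤m+n j d))))) ⟩
    #first≤ (j + suc d) j + #first≤ (j + d) j
      ≡⟨ cong₂ _+_ (#first≤-binom j (suc d)) (#first≤-binom j d) ⟩
    ℕB.binom 1 j (λ k → #base (k + suc d)) + ℕB.binom 1 j (λ k → #base (k + d))
      ≡⟨ cong (_+ ℕB.binom 1 j (λ k → #base (k + d))) (ℕB.binom-cong 1 j λ k _ → cong #base (+-suc k d)) ⟩
    ℕB.binom 1 j (λ k → #base (suc k + d)) + ℕB.binom 1 j (λ k → #base (k + d))
      ≡⟨ trans (+-comm (ℕB.binom 1 j (λ k → #base (suc k + d))) _)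
               (cong (_+ ℕB.binom 1 j (λ k → #base (suc k + d))) (sym (*-identityˡ _))) ⟩
    1 * ℕB.binom 1 j (λ k → #base (k + d)) + ℕB.binom 1 j (λ k → #base (suc k + d))
      ≡⟨ ℕB.binom-suc 1 j _ ⟨
    ℕB.binom 1 (suc j) (λ k → #base (k + d)) ∎
    where open ≡-Reasoning

  count-Γ : ∀ n → count {suc r} {suc n} Γ Γ? ≡ ℕΣ.∑< (suc n) (λ k → (n C k) * #base k)
  count-Γ n = begin
    count {n = suc n} Γ Γ?
      -- At `j = n` the bound on the first letter always holds.
      ≡⟨ count-cong Γ? (Γ₁≤? n) (λ w → mk⇔ (λ γ → γ , s≤s⁻¹ (toℕ<n (σ w ⟨$⟩ʳ zero))) proj₁) ⟩
    #first≤ n n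
      ≡⟨ cong (λ m → #first≤ m n) (+-identityʳ n) ⟨
    #first≤ (n + 0) n
      ≡⟨ #first≤-binom n 0 ⟩
    ℕB.binom 1 n (λ k → #base (k + 0))
      ≡⟨ ℕB.binom-1 n _ ⟩
    _
      ≡⟨ ℕΣ.∑<-cong (suc n) (λ k _ → trans (×≡* (n C k)) (cong (λ m → (n C k) * #base m) (+-identityʳ k))) ⟩
    ℕΣ.∑< (suc n) (λ k → (n C k) * #base k) ∎
    where
    open ≡-Reasoning
    open import Algebra.Properties.Semiring.Mult +-*-semiring using () renaming (_×_ to _·_)
    ×≡* : ∀ m {x} → m · x ≡ m * x
    ×≡* zero        = refl
    ×≡* (suc m) {x} = cong (x +_) (×≡* m)

-- Subsets without two consecutive elements

noTwoConsecutive-tail : ∀ {n b} {S : Subset n} → NoTwoConsecutive (b ∷ S) → NoTwoConsecutive S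
noTwoConsecutive-tail no2 j k j∈S k∈S eq = no2 (suc j) (suc k) (there j∈S) (there k∈S) (cong suc eq)

noTwoConsecutive-outside : ∀ {n} {S : Subset n} → NoTwoConsecutive S → NoTwoConsecutive (outside ∷ S)
noTwoConsecutive-outside no2 (suc j) (suc k) (there j∈S) (there k∈S) eq = no2 j k j∈S k∈S (suc-injective eq)

-- The only new danger is the first position of `S`, which becomes adjacent to the added element;
-- the lower bound 2 excludes it.
noTwoConsecutive-inside : ∀ {n b} {S : Subset n} → S ⊆[ 2 , b ] → NoTwoConsecutive S →
                          NoTwoConsecutive (inside ∷ S)
noTwoConsecutive-inside S⊆ no2 zero (suc zero) _ (there 0∈S) eq with () ← s≤s⁻¹ (proj₁ (S⊆ zero 0∈S))
noTwoConsecutive-inside S⊆ no2 (suc j) (suc k) (there j∈S) (there k∈S) eq = no2 j k j∈S k∈S (suc-injective eq)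

-- This is how the lower bound 2 in the definitions of `ξ⁺` and `ξ⁻` arises from a preceding letter
-- 1.
noTwoConsecutive-inside⇒2≤ : ∀ {n} {S : Subset n} → NoTwoConsecutive (inside ∷ S) → ∀ k → k ∈ S → 2 ≤ pos k
noTwoConsecutive-inside⇒2≤ no2 zero    0∈S = contradiction refl (no2 zero (suc zero) here (there 0∈S))
noTwoConsecutive-inside⇒2≤ no2 (suc k) k∈S = s≤s (s≤s z≤n)

∋-tail : ∀ {n s p} {S : Subset n} → 1 ≤ p → (s ∷ S) ∋ suc p → S ∋ p
∋-tail 1≤p (zero  , refl , _)         with () ← 1≤p
∋-tail 1≤p (suc k , refl , there k∈S) = k , refl , k∈S

∋-∷ : ∀ {n s p} {S : Subset n} → S ∋ p → (s ∷ S) ∋ suc p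
∋-∷ (k , eq , k∈S) = suc k , cong suc eq , there k∈S

⊆-tail : ∀ {n s b} {S : Subset n} → (s ∷ S) ⊆[ 1 , suc b ] → S ⊆[ 1 , b ]
⊆-tail S⊆ k k∈S = s≤s z≤n , s≤s⁻¹ (proj₂ (S⊆ (suc k) (there k∈S)))

⊆-outside : ∀ {n b} {S : Subset n} → S ⊆[ 1 , b ] → (outside ∷ S) ⊆[ 1 , suc b ]
⊆-outside S⊆ (suc k) (there k∈S) = s≤s z≤n , s≤s (proj₂ (S⊆ k k∈S))

⊆-inside : ∀ {n b} {S : Subset n} → S ⊆[ 2 , b ] → (inside ∷ S) ⊆[ 1 , suc b ]
⊆-inside S⊆ zero    _           = s≤s z≤n , s≤s z≤n
⊆-inside S⊆ (suc k) (there k∈S) = s≤s z≤n , s≤s (proj₂ (S⊆ k k∈S))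

∈⇒∣S∣>0 : ∀ {n} {S : Subset n} {k} → k ∈ S → ∣ S ∣ > 0
∈⇒∣S∣>0 {S = inside  ∷ S} _           = s≤s z≤n
∈⇒∣S∣>0 {S = outside ∷ S} (there k∈S) = ∈⇒∣S∣>0 k∈S

-- An element in first position excludes the second one, so it pays for two positions, and `⌈ b /2⌉`
-- grows by one when `b` grows by two.
∣S∣≤⌈b/2⌉ : ∀ {n} (S : Subset n) b → NoTwoConsecutive S → S ⊆[ 1 , b ] → ∣ S ∣ ≤ ⌈ b /2⌉
∣S∣≤⌈b/2⌉ []            b       no2 S⊆ = z≤n
-- The bound 0 leaves no room for elements; it stays 0 while the rest of the vector is traversed.
∣S∣≤⌈b/2⌉ (outside ∷ S) zero    no2 S⊆ =
  ∣S∣≤⌈b/2⌉ S 0 (noTwoConsecutive-tail no2) λ k k∈S → s≤s z≤n , contradiction (proj₂ (S⊆ (suc k) (there k∈S))) λ ()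
∣S∣≤⌈b/2⌉ (outside ∷ S) (suc b) no2 S⊆ =
  ≤-trans (∣S∣≤⌈b/2⌉ S b (noTwoConsecutive-tail no2) (⊆-tail S⊆)) (⌈n/2⌉-mono (n≤1+n b))
∣S∣≤⌈b/2⌉ (inside ∷ S)  zero    no2 S⊆ with () ← proj₂ (S⊆ zero here)
∣S∣≤⌈b/2⌉ (inside ∷ []) (suc b) no2 S⊆ = s≤s z≤n
∣S∣≤⌈b/2⌉ (inside ∷ inside ∷ S)  (suc b) no2 S⊆ =
  contradiction refl (no2 zero (suc zero) here (there here))
∣S∣≤⌈b/2⌉ (inside ∷ outside ∷ S) 1 no2 S⊆ =
  s≤s (∣S∣≤⌈b/2⌉ S 0 (noTwoConsecutive-tail (noTwoConsecutive-tail no2))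
    λ k k∈S → s≤s z≤n , contradiction (proj₂ (S⊆ (suc (suc k)) (there (there k∈S)))) λ { (s≤s ()) })
∣S∣≤⌈b/2⌉ (inside ∷ outside ∷ S) (suc (suc b)) no2 S⊆ =
  s≤s (∣S∣≤⌈b/2⌉ S b (noTwoConsecutive-tail (noTwoConsecutive-tail no2)) (⊆-tail (⊆-tail S⊆)))

-- The first position is empty; dropping it shifts the interval to {1,...,b}.
∣S∣≤⌈b/2⌉₂ : ∀ {n} (S : Subset n) b → NoTwoConsecutive S → S ⊆[ 2 , suc b ] → ∣ S ∣ ≤ ⌈ b /2⌉
∣S∣≤⌈b/2⌉₂ []            b no2 S⊆ = z≤n
∣S∣≤⌈b/2⌉₂ (inside  ∷ S) b no2 S⊆ with s≤s () ← proj₁ (S⊆ zero here)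
∣S∣≤⌈b/2⌉₂ (outside ∷ S) b no2 S⊆ =
  ∣S∣≤⌈b/2⌉ S b (noTwoConsecutive-tail no2)
    λ k k∈S → s≤s z≤n , s≤s⁻¹ (proj₂ (S⊆ (suc k) (there k∈S)))

m≤⌊n/2⌋⇒2*m≤n : ∀ {m n} → m ≤ ⌊ n /2⌋ → 2 * m ≤ n
m≤⌊n/2⌋⇒2*m≤n {m} {n} m≤ rewrite +-identityʳ m =
  subst (m + m ≤_) (⌊n/2⌋+⌈n/2⌉≡n n) (+-mono-≤ m≤ (≤-trans m≤ (⌊n/2⌋≤⌈n/2⌉ n)))

-- Vanishing of the numbers ξ

ξ⁺-zero : ∀ n r → ξ⁺ (suc n) r 0 ≡ 0
ξ⁺-zero n r = count-none {r} {suc n} (inΞ⁺? 0) λ w (_ , ∣S∣≡0 , _ , _ , _ , k∈S) →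
  contradiction ∣S∣≡0 (>⇒≢ (∈⇒∣S∣>0 k∈S))

ξ⁻-zero : ∀ n r → ξ⁻ n r 0 ≡ 0
ξ⁻-zero zero    r = refl
ξ⁻-zero (suc n) r = count-none {r} {suc n} (inΞ⁻? 0) λ { w (_ , () , _) }

-- At size n+1 the ascents lie in {2,...,n+1}, so there are at most `⌈ n /2⌉` of them, which is
-- `⌊ suc n /2⌋` by definition.
ξ⁺-vanish : ∀ n r i → n < 2 * i → ξ⁺ n r i ≡ 0
ξ⁺-vanish zero    r (suc i) _   = refl
ξ⁺-vanish (suc n) r i       n<2i = count-none {r} {suc n} (inΞ⁺? i) λ { w (S⊆ , refl , no2 , _) →
  <⇒≱ n<2i (m≤⌊n/2⌋⇒2*m≤n (∣S∣≤⌈b/2⌉₂ (Asc w) n no2 S⊆)) }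

-- Since `i` exceeds the number of ascents by one while the interval ends at n-1, the estimate is i
-- - 1 ≤ ⌊(n-1)/2⌋, that is, 2i ≤ n+1. Hence the value k = 2i-1 is still possible.
ξ⁻-vanish : ∀ n r i → suc n < 2 * i → ξ⁻ n r i ≡ 0
ξ⁻-vanish zero    r i _    = refl
ξ⁻-vanish (suc n) r i n<2i = count-none {r} {suc n} (inΞ⁻? i) λ { w (S⊆ , refl , no2) →
  <⇒≱ n<2i (m≤⌊n/2⌋⇒2*m≤n (s≤s (bound n w S⊆ no2))) }
  where
  bound : ∀ n (w : ColoredPerm r (suc n)) → Asc w ⊆[ 2 , n ] → NoTwoConsecutive (Asc w) → ∣ Asc w ∣ ≤ ⌊ n /2⌋
  -- Here the interval is [2, 0], which is widened to [2, 1] to fit the form [2, `suc b`].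
  bound zero    w S⊆ no2 = ∣S∣≤⌈b/2⌉₂ (Asc w) 0 no2 λ k k∈S → proj₁ (S⊆ k k∈S) , m≤n⇒m≤1+n (proj₂ (S⊆ k k∈S))
  bound (suc n) w S⊆ no2 = ∣S∣≤⌈b/2⌉₂ (Asc w) n no2 S⊆

-- The two conditions on ascent sets

module _ (i : ℕ) where

  -- The upper limits are measured from the end of the word, so they move along when an initial
  -- descent is removed.
  Q⁺ Q⁻ : ∀ {n} → Subset (suc n) → Set
  Q⁺ {n} S = ∣ S ∣ ≡ i + 1 × NoTwoConsecutive S × S ∋ n + 1
  Q⁻ {n} S = S ⊆[ 1 , n ] × ∣ S ∣ ≡ i × NoTwoConsecutive S

  Q⁺? : ∀ {n} → Decidable (Q⁺ {n})
  Q⁺? {n} S = (∣ S ∣ ≟ i + 1) ×-dec noTwoConsecutive? S ×-dec (S ∋? (n + 1))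

  Q⁻? : ∀ {n} → Decidable (Q⁻ {n})
  Q⁻? {n} S = (S ⊆[ 1 , n ]?) ×-dec (∣ S ∣ ≟ i) ×-dec noTwoConsecutive? S

  Q⁺-outside : ∀ {n} {S : Subset (suc n)} → Q⁺ (outside ∷ S) ⇔ Q⁺ S
  Q⁺-outside {n} = mk⇔
    (λ (c , no2 , last) → c , noTwoConsecutive-tail no2 , ∋-tail (m≤n+m 1 n) last)
    (λ (c , no2 , last) → c , noTwoConsecutive-outside no2 , ∋-∷ last)

  Q⁻-outside : ∀ {n} {S : Subset (suc n)} → Q⁻ (outside ∷ S) ⇔ Q⁻ S
  Q⁻-outside = mk⇔
    (λ (S⊆ , c , no2) → ⊆-tail S⊆ , c , noTwoConsecutive-tail no2)
    (λ (S⊆ , c , no2) → ⊆-outside S⊆ , c , noTwoConsecutive-outside no2)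

module P⁺ (r i : ℕ) = Prepend {r} (Q⁺ i) (Q⁺? i) (Q⁺-outside i)
module P⁻ (r i : ℕ) = Prepend {r} (Q⁻ i) (Q⁻? i) (Q⁻-outside i)

-- The letter 1 in front accounts for one of the i+1 ascents, and its position forces the others to
-- start at 2 after renumbering.
#base⁺≡ξ⁺ : ∀ r i n → P⁺.#base r i n ≡ ξ⁺ n (suc r) i
-- The single letter 1 has ascent set {1}, which agrees with the convention for `ξ⁺` at size 0.
#base⁺≡ξ⁺ r zero    zero    = refl
#base⁺≡ξ⁺ r (suc i) zero    = count-none (P⁺.base? r (suc i) {0}) λ w (c , _) →
  contradiction (trans (suc-injective c) (+-comm i 1)) λ ()
#base⁺≡ξ⁺ r i       (suc n) = count-cong (P⁺.base? r i {suc n}) (inΞ⁺? i) λ w → mk⇔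
  (λ (c , no2 , last) →
      (λ k k∈S → noTwoConsecutive-inside⇒2≤ no2 k k∈S , toℕ<n k)
    , suc-injective (trans c (+-comm i 1))
    , noTwoConsecutive-tail no2
    , ∋-tail (s≤s z≤n) (subst ((inside ∷ Asc w) ∋_) (+-comm (suc n) 1) last))
  (λ (S⊆ , c , no2 , last) →
      trans (cong suc c) (+-comm 1 i)
    , noTwoConsecutive-inside S⊆ no2
    , subst ((inside ∷ Asc w) ∋_) (+-comm 1 (suc n)) (∋-∷ last))

-- Here `i` counts the ascent at the front as well, so i - 1 remain. At size 0 that ascent violates
-- the bound, in accordance with the value 0 of `ξ⁻`.
#base⁻≡ξ⁻ : ∀ r i n → P⁻.#base r i n ≡ ξ⁻ n (suc r) i
#base⁻≡ξ⁻ r i zero    = count-none (P⁻.base? r i {0}) λ w (S⊆ , _) → contradiction (proj₂ (S⊆ zero here)) λ ()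
#base⁻≡ξ⁻ r i (suc n) = count-cong (P⁻.base? r i {suc n}) (inΞ⁻? i) λ w → mk⇔
  (λ (S⊆ , c , no2) →
      (λ k k∈S → noTwoConsecutive-inside⇒2≤ no2 k k∈S , proj₂ (⊆-tail S⊆ k k∈S))
    , c , noTwoConsecutive-tail no2)
  (λ (S⊆ , c , no2) → ⊆-inside S⊆ , c , noTwoConsecutive-inside S⊆ no2)

count-InΓ⁺ : ∀ r i n → count {suc r} {suc n} (InΓ⁺ i) (inΓ⁺? i) ≡ ℕΣ.∑< (suc n) (λ k → (n C k) * ξ⁺ k (suc r) i)
count-InΓ⁺ r i n = trans
  (count-cong (inΓ⁺? {n = n} i) (P⁺.Γ? r i)
    λ w → mk⇔ (λ (a , b , c , d) → (a , b , c) , d) (λ ((a , b , c) , d) → a , b , c , d))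
  (trans (P⁺.count-Γ r i n) (ℕΣ.∑<-cong (suc n) λ k _ → cong ((n C k) *_) (#base⁺≡ξ⁺ r i k)))

count-InΓ⁻ : ∀ r i n → count {suc r} {suc n} (InΓ⁻ i) (inΓ⁻? i) ≡ ℕΣ.∑< (suc n) (λ k → (n C k) * ξ⁻ k (suc r) i)
count-InΓ⁻ r i n = trans
  (count-cong (inΓ⁻? {n = n} i) (P⁻.Γ? r i)
    λ w → mk⇔ (λ (a , b , c , d) → (a , b , c) , d) (λ ((a , b , c) , d) → a , b , c , d))
  (trans (P⁻.count-Γ r i n) (ℕΣ.∑<-cong (suc n) λ k _ → cong ((n C k) *_) (#base⁻≡ξ⁻ r i k)))

-- The γ-expansions

module PolySum = BinomialTransform polyCommutativeSemiring
module Polynomial = CommutativeSemiring polyCommutativeSemiring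
open import Relation.Binary.Reasoning.Setoid Polynomial.setoid

⌊n/2⌋<m⇒n<2*m : ∀ {m n} → ⌊ n /2⌋ < m → n < 2 * m
⌊n/2⌋<m⇒n<2*m {m} {n} <m = ≰⇒> λ 2m≤n → <⇒≱ <m
  (subst (_≤ ⌊ n /2⌋) (sym (n≡⌊n+n/2⌋ m))
    (⌊n/2⌋-mono (subst (λ k → m + k ≤ n) (+-identityʳ m) 2m≤n)))

n<2m∸1⇒1+n<2m : ∀ {k} m → k < m ∸ 1 → suc k < m
n<2m∸1⇒1+n<2m (suc m) k<m = s≤s k<m

⌊n+1/2⌋≤n : ∀ n → ⌊ n + 1 /2⌋ ≤ n
⌊n+1/2⌋≤n n rewrite +-comm n 1 = ⌈n/2⌉≤n n

·ᵖ-zero : ∀ {c} p → c ≡ 0 → c ·ᵖ p ≈ᵖ []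
·ᵖ-zero p refl k = refl

Ã≈binom : ∀ n (d : ℕ → Poly) →
  ∑ᵖ[ m from 0 to n ] ((n C m) ·ᵖ (t ^ᵖ (n ∸ m) *ᵖ ∑ᵖ[ k from 0 to m ] ((m C k) ·ᵖ d k))) ≈ᵖ
  PolySum.binom (1ᵖ +ᵖ t) n d
Ã≈binom n d = begin
  ∑ᵖ[ m from 0 to n ] ((n C m) ·ᵖ (t ^ᵖ (n ∸ m) *ᵖ ∑ᵖ[ k from 0 to m ] ((m C k) ·ᵖ d k)))
    ≈⟨ ∑[0,n] n _ ⟩
  PolySum.binom t n (λ m → ∑ᵖ[ k from 0 to m ] ((m C k) ·ᵖ d k))
    ≈⟨ PolySum.binom-cong t n (λ m _ → A≈binom m) ⟩
  PolySum.binom t n (λ m → PolySum.binom 1ᵖ m d)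
    ≈⟨ PolySum.binom-binom t 1ᵖ n d ⟩
  PolySum.binom (t +ᵖ 1ᵖ) n d
    ≈⟨ PolySum.binom-congˡ n d (Polynomial.+-comm t 1ᵖ) ⟩
  PolySum.binom (1ᵖ +ᵖ t) n d ∎
  where
  ∑[0,n] : ∀ n (f : ℕ → Poly) → ∑ᵖ[ k from 0 to n ] ((n C k) ·ᵖ f k) ≈ᵖ PolySum.∑< (suc n) (λ k → (n C k) ·ᵖ f k)
  ∑[0,n] n f = PolySum.∑[,]≈∑< 0 n (λ k → (n C k) ·ᵖ f k) ≤-refl (λ _ ()) (λ k n<k → ·ᵖ-zero (f k) (k>n⇒nCk≡0 n<k))
  A≈binom : ∀ m → ∑ᵖ[ k from 0 to m ] ((m C k) ·ᵖ d k) ≈ᵖ PolySum.binom 1ᵖ m d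
  A≈binom m = begin
    ∑ᵖ[ k from 0 to m ] ((m C k) ·ᵖ d k)       ≈⟨ ∑[0,n] m d ⟩
    PolySum.∑< (suc m) (λ k → (m C k) ·ᵖ d k)     ≈⟨ PolySum.binom-1 m d ⟨
    PolySum.binom 1ᵖ m d                          ∎

-- The γ-basis for palindromic polynomials with center of symmetry e/2.
basis : ℕ → ℕ → Poly
basis e i = t ^ᵖ i *ᵖ (1ᵖ +ᵖ t) ^ᵖ (e ∸ 2 * i)

-- The range of `i` is made independent of `k`, so that the sums over `k` and `i` can be
-- interchanged. For positive `k` the added terms vanish; for `k = 0` the term `i = 0` is the
-- polynomial 1.
d⁺≈∑< : ∀ r {n} k → k ≤ n → d⁺ k r ≈ᵖ PolySum.∑< (suc n) (λ i → ξ⁺ k r i ·ᵖ basis k i)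
d⁺≈∑< r zero    k≤n = PolySum.∑[,]≈∑< 0 0 (λ i → ξ⁺ 0 r i ·ᵖ basis 0 i) (s≤s z≤n) (λ _ ()) λ { (suc i) _ k → refl }
d⁺≈∑< r (suc k) k≤n = PolySum.∑[,]≈∑< 1 ⌊ suc k /2⌋ (λ i → ξ⁺ (suc k) r i ·ᵖ basis (suc k) i)
  (s≤s (≤-trans (⌊n/2⌋≤n (suc k)) k≤n))
  (λ { zero _ → ·ᵖ-zero (basis (suc k) 0) (ξ⁺-zero k r) ; (suc i) (s≤s ()) })
  (λ i k/2<i → ·ᵖ-zero (basis (suc k) i) (ξ⁺-vanish (suc k) r i (⌊n/2⌋<m⇒n<2*m k/2<i)))

ξ⁻-vanish′ : ∀ n r i → ⌊ n + 1 /2⌋ < i → ξ⁻ n r i ≡ 0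
ξ⁻-vanish′ n r i n/2<i = ξ⁻-vanish n r i (subst (_< 2 * i) (+-comm n 1) (⌊n/2⌋<m⇒n<2*m n/2<i))

d⁻≈∑< : ∀ r {n} k → k ≤ n → d⁻ k r ≈ᵖ PolySum.∑< (suc n) (λ i → ξ⁻ k r i ·ᵖ basis (k + 1) i)
d⁻≈∑< r {n} zero    k≤n k = sym (PolySum.∑<-zero (suc n) {λ i → ξ⁻ 0 r i ·ᵖ basis 1 i} (λ i k → refl) k)
d⁻≈∑< r (suc k) k≤n = PolySum.∑[,]≈∑< 1 ⌊ suc k + 1 /2⌋ (λ i → ξ⁻ (suc k) r i ·ᵖ basis (suc k + 1) i)
  (s≤s (≤-trans (⌊n+1/2⌋≤n (suc k)) k≤n))
  (λ { zero _ → ·ᵖ-zero (basis (suc k + 1) 0) (ξ⁻-zero (suc k) r) ; (suc i) (s≤s ()) })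
  (λ i k/2<i → ·ᵖ-zero (basis (suc k + 1) i) (ξ⁻-vanish′ (suc k) r i k/2<i))

*≡0 : ∀ m {k} → k ≡ 0 → m * k ≡ 0
*≡0 m refl = *-zeroʳ m

C*≡0 : ∀ {n k} m → n < k → (n C k) * m ≡ 0
C*≡0 {n} {k} m n<k rewrite k>n⇒nCk≡0 n<k = refl

γ̃⁺≡∑< : ∀ n r i → γ̃⁺ n r i ≡ ℕΣ.∑< (suc n) (λ k → (n C k) * ξ⁺ k r i)
γ̃⁺≡∑< n r i = ℕΣ.∑[,]≈∑< (2 * i) n (λ k → (n C k) * ξ⁺ k r i) ≤-refl
  (λ k k<2i → *≡0 (n C k) (ξ⁺-vanish k r i k<2i)) (λ k n<k → C*≡0 (ξ⁺ k r i) n<k)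

-- The omitted indices k < 2i-1 satisfy k+1 < 2i, which is the range of `ξ⁻-vanish`.
γ̃⁻≡∑< : ∀ n r i → γ̃⁻ n r i ≡ ℕΣ.∑< (suc n) (λ k → (n C k) * ξ⁻ k r i)
γ̃⁻≡∑< n r i = ℕΣ.∑[,]≈∑< (2 * i ∸ 1) n (λ k → (n C k) * ξ⁻ k r i) ≤-refl
  (λ k k<2i-1 → *≡0 (n C k) (ξ⁻-vanish k r i (n<2m∸1⇒1+n<2m (2 * i) k<2i-1))) (λ k n<k → C*≡0 (ξ⁻ k r i) n<k)

∑<-C*≡0 : ∀ n (f : ℕ → ℕ) → (∀ k → k ≤ n → f k ≡ 0) → ℕΣ.∑< (suc n) (λ k → (n C k) * f k) ≡ 0
∑<-C*≡0 n f f≡0 = trans (ℕΣ.∑<-cong (suc n) λ { k (s≤s k≤n) → *≡0 (n C k) (f≡0 k k≤n) })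
                        (ℕΣ.∑<-zero (suc n) λ _ → refl)

-- The hypothesis `c ≤ b` guards against truncation; when it fails in the expansions, the
-- coefficient ξ is zero instead.
n∸k+[b∸c]≡a∸c : ∀ {n k} a b c → k ≤ n → n ∸ k + b ≡ a → c ≤ b → n ∸ k + (b ∸ c) ≡ a ∸ c
n∸k+[b∸c]≡a∸c {n} {k} a b c k≤n refl c≤b = sym (+-∸-assoc (n ∸ k) c≤b)

Ã⁺-expansion : ∀ n r →
  Ã⁺ n r ≈ᵖ ∑ᵖ[ i from 0 to ⌊ n /2⌋ ] (γ̃⁺ n r i ·ᵖ (t ^ᵖ i *ᵖ (1ᵖ +ᵖ t) ^ᵖ (n ∸ 2 * i)))
Ã⁺-expansion n r = begin
  Ã⁺ n r
    ≈⟨ Ã≈binom n (λ k → d⁺ k r) ⟩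
  PolySum.binom (1ᵖ +ᵖ t) n (λ k → d⁺ k r)
    ≈⟨ PolySum.binom-cong (1ᵖ +ᵖ t) n (λ k k≤n → d⁺≈∑< r k k≤n) ⟩
  PolySum.binom (1ᵖ +ᵖ t) n (λ k → PolySum.∑< (suc n) (λ i → ξ⁺ k r i ·ᵖ basis k i))
    ≈⟨ PolySum.binom-∑< t (1ᵖ +ᵖ t) n (suc n) (λ k → ξ⁺ k r) id vanish ⟩
  PolySum.∑< (suc n) (λ i → ℕΣ.∑< (suc n) (λ k → (n C k) * ξ⁺ k r i) ·ᵖ basis n i)
    ≈⟨ PolySum.∑<-cong (suc n) (λ i _ → Polynomial.reflexive (cong (_·ᵖ basis n i) (γ̃⁺≡∑< n r i))) ⟨
  PolySum.∑< (suc n) (λ i → γ̃⁺ n r i ·ᵖ basis n i)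
    -- For `i` above `⌊ n /2⌋`, every k ≤ n is below 2i, so the whole coefficient vanishes.
    ≈⟨ PolySum.∑[,]≈∑< 0 ⌊ n /2⌋ (λ i → γ̃⁺ n r i ·ᵖ basis n i) (s≤s (⌊n/2⌋≤n n)) (λ _ ())
         (λ i n/2<i → ·ᵖ-zero (basis n i) (trans (γ̃⁺≡∑< n r i) (∑<-C*≡0 n (λ k → ξ⁺ k r i)
           λ k k≤n → ξ⁺-vanish k r i (≤-<-trans k≤n (⌊n/2⌋<m⇒n<2*m n/2<i))))) ⟨
  ∑ᵖ[ i from 0 to ⌊ n /2⌋ ] (γ̃⁺ n r i ·ᵖ basis n i) ∎
  where
  vanish : ∀ k i → k ≤ n → ξ⁺ k r i ≡ 0 ⊎ (n ∸ k) + (k ∸ 2 * i) ≡ n ∸ 2 * i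
  vanish k i k≤n with 2 * i ≤? k
  ... | yes 2i≤k = inj₂ (n∸k+[b∸c]≡a∸c n k (2 * i) k≤n (m∸n+n≡m k≤n) 2i≤k)
  ... | no  2i≰k = inj₁ (ξ⁺-vanish k r i (≰⇒> 2i≰k))

Ã⁻-expansion : ∀ n r →
  Ã⁻ n r ≈ᵖ ∑ᵖ[ i from 1 to ⌊ n + 1 /2⌋ ] (γ̃⁻ n r i ·ᵖ (t ^ᵖ i *ᵖ (1ᵖ +ᵖ t) ^ᵖ (n + 1 ∸ 2 * i)))
Ã⁻-expansion n r = begin
  Ã⁻ n r
    ≈⟨ Ã≈binom n (λ k → d⁻ k r) ⟩
  PolySum.binom (1ᵖ +ᵖ t) n (λ k → d⁻ k r)
    ≈⟨ PolySum.binom-cong (1ᵖ +ᵖ t) n (λ k k≤n → d⁻≈∑< r k k≤n) ⟩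
  PolySum.binom (1ᵖ +ᵖ t) n (λ k → PolySum.∑< (suc n) (λ i → ξ⁻ k r i ·ᵖ basis (k + 1) i))
    ≈⟨ PolySum.binom-∑< t (1ᵖ +ᵖ t) n (suc n) (λ k → ξ⁻ k r) (_+ 1) vanish ⟩
  PolySum.∑< (suc n) (λ i → ℕΣ.∑< (suc n) (λ k → (n C k) * ξ⁻ k r i) ·ᵖ basis (n + 1) i)
    ≈⟨ PolySum.∑<-cong (suc n) (λ i _ → Polynomial.reflexive (cong (_·ᵖ basis (n + 1) i) (γ̃⁻≡∑< n r i))) ⟨
  PolySum.∑< (suc n) (λ i → γ̃⁻ n r i ·ᵖ basis (n + 1) i)
    -- The sum may start at 1, since `ξ⁻ k r 0` is 0 for all `k`.
    ≈⟨ PolySum.∑[,]≈∑< 1 ⌊ n + 1 /2⌋ (λ i → γ̃⁻ n r i ·ᵖ basis (n + 1) i) (s≤s (⌊n+1/2⌋≤n n))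
         (λ { zero _ → ·ᵖ-zero (basis (n + 1) 0) (trans (γ̃⁻≡∑< n r 0) (∑<-C*≡0 n (λ k → ξ⁻ k r 0)
                λ k _ → ξ⁻-zero k r))
            ; (suc i) (s≤s ()) })
         (λ i n/2<i → ·ᵖ-zero (basis (n + 1) i) (trans (γ̃⁻≡∑< n r i) (∑<-C*≡0 n (λ k → ξ⁻ k r i)
           λ k k≤n → ξ⁻-vanish′ k r i (≤-<-trans (⌊n/2⌋-mono (+-monoˡ-≤ 1 k≤n)) n/2<i)))) ⟨
  ∑ᵖ[ i from 1 to ⌊ n + 1 /2⌋ ] (γ̃⁻ n r i ·ᵖ basis (n + 1) i) ∎
  where
  vanish : ∀ k i → k ≤ n → ξ⁻ k r i ≡ 0 ⊎ (n ∸ k) + (k + 1 ∸ 2 * i) ≡ n + 1 ∸ 2 * i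
  vanish k i k≤n with 2 * i ≤? k + 1
  ... | yes 2i≤k = inj₂ (n∸k+[b∸c]≡a∸c (n + 1) (k + 1) (2 * i) k≤n
                     (trans (sym (+-assoc (n ∸ k) k 1)) (cong (_+ 1) (m∸n+n≡m k≤n))) 2i≤k)
  ... | no  2i≰k = inj₁ (ξ⁻-vanish k r i (subst (_< 2 * i) (+-comm k 1) (≰⇒> 2i≰k)))

corollary3p3 : (n r : ℕ) → 1 ≤ n → 2 ≤ r →
    Ã⁺ n r ≈ᵖ ∑ᵖ[ i from 0 to ⌊ n /2⌋ ] (γ̃⁺ n r i ·ᵖ (t ^ᵖ i *ᵖ (1ᵖ +ᵖ t) ^ᵖ (n ∸ 2 * i)))
    × Ã⁻ n r ≈ᵖ ∑ᵖ[ i from 1 to ⌊ n + 1 /2⌋ ] (γ̃⁻ n r i ·ᵖ (t ^ᵖ i *ᵖ (1ᵖ +ᵖ t) ^ᵖ (n + 1 ∸ 2 * i)))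
    × (∀ i → γ̃⁺ n r i ≡ count {r} {suc n} (InΓ⁺ i) (inΓ⁺? i))
    × (∀ i → γ̃⁻ n r i ≡ count {r} {suc n} (InΓ⁻ i) (inΓ⁻? i))
corollary3p3 n (suc r) _ _ =
    Ã⁺-expansion n (suc r)
  , Ã⁻-expansion n (suc r)
  , (λ i → trans (γ̃⁺≡∑< n (suc r) i) (sym (count-InΓ⁺ r i n)))
  , (λ i → trans (γ̃⁻≡∑< n (suc r) i) (sym (count-InΓ⁻ r i n)))
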